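{- $\mathsf{D}_0(C_2^5)=11$ and $k_{\mathsf{D}}(C_2^5)=10$. Additionally, $\mathsf{D}_{1}(C_2^5)=6$, $\mathsf{D}_{2}(C_2^5)=10$, $\mathsf{D}_{3}(C_2^5)=13$, $\mathsf{D}_{4}(C_2^5)=16$, $\mathsf{D}_{5}(C_2^5)=19$, $\mathsf{D}_{6}(C_2^5)=21$, $\mathsf{D}_{7}(C_2^5)=23$, $\mathsf{D}_{8}(C_2^5)=26$, and $\mathsf{D}_{9}(C_2^5)=28$.
   Context: $C_2^5$ is the elementary abelian $2$-group of rank $5$. A sequence over a finite abelian group $G$ is a finite unordered list of elements with repetitions; zero-sum means its terms sum to $0$. $\mathsf{D}_k(G)$ ($k\in\mathbb{N}$) is the smallest $\ell$ such that every sequence over $G$ of length at least $\ell$ has $k$ disjoint non-empty zero-sum subsequences. It is known that there exists $\mathsf{D}_0(G)\in\mathbb{N}_0$ with $\mathsf{D}_k(G)=\mathsf{D}_0(G)+k\exp(G)$ for all sufficiently large $k$; $k_{\mathsf{D}}(G)$ is the minimal $k_0\in\mathbb{N}$ with $\mathsf{D}_k(G)=\mathsf{D}_0(G)+k\exp(G)$ for all $k\ge k_0$. -}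

module Defs where

open import Algebra.Bundles using (AbelianGroup)
import Algebra.Construct.Pointwise as Pointwise
import Algebra.Definitions.RawMonoid as RawMonoidDefs
open import Data.Fin.Base using (Fin)
open import Data.List.Base using (List; []; _++_; concat; foldr; length)
import Data.List.Relation.Binary.Permutation.Setoid as Permutation
open import Data.List.Relation.Unary.All using (All)
open import Data.Nat.Base using (ℕ; _+_; _*_; _≤_)
import Data.Parity.Properties as Parity
open import Data.Product.Base using (_×_; ∃-syntax)
open import Level using (Level; 0ℓ; _⊔_)
open import Relation.Binary.PropositionalEquality.Core using (_≡_; _≢_)

IsLeast : ∀ {p} → (ℕ → Set p) → ℕ → Set p
IsLeast P n = P n × (∀ m → P m → n ≤ m)

-- The elementary abelian 2-group of rank r, as the r-fold power of the additive
-- group of parities; its equality is pointwise.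
C₂^ : ℕ → AbelianGroup 0ℓ 0ℓ
C₂^ r = Pointwise.abelianGroup (Fin r) Parity.+-0-abelianGroup

module _ {c ℓ : Level} (G : AbelianGroup c ℓ) where

  open AbelianGroup G using (Carrier; _≈_; _∙_; ε; setoid; rawMonoid)
  open Permutation setoid using (_↭_)
  open RawMonoidDefs rawMonoid using () renaming (_×_ to _·_)

  -- Sequences are represented by lists. The unordered reading enters through _↭_,
  -- which is equality in the free abelian monoid over G.
  Sequence : Set c
  Sequence = List Carrier

  σ : Sequence → Carrier
  σ = foldr _∙_ ε

  NonEmptyZeroSum : Sequence → Set (c ⊔ ℓ)
  NonEmptyZeroSum T = T ≢ [] × σ T ≈ ε

  -- T₁, …, Tₖ are disjoint subsequences of S when their product T₁⋯Tₖ divides S in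
  -- the free abelian monoid over G; R is the cofactor.
  HasDisjointZeroSums : ℕ → Sequence → Set (c ⊔ ℓ)
  HasDisjointZeroSums k S =
    ∃[ Ts ] ∃[ R ] length Ts ≡ k × All NonEmptyZeroSum Ts × S ↭ concat Ts ++ R

  -- "D_k(G) = n", for k ≥ 1.  At k = 0 this relation says n = 0; the constant
  -- written D_0(G) is not that value but the one given by IsD₀.
  IsD : (k n : ℕ) → Set (c ⊔ ℓ)
  IsD k = IsLeast λ n → ∀ (S : Sequence) → n ≤ length S → HasDisjointZeroSums k S

  IsExponent : ℕ → Set (c ⊔ ℓ)
  IsExponent = IsLeast λ e → 1 ≤ e × (∀ g → e · g ≈ ε)

  EventuallyLinearFrom : (e d k₀ : ℕ) → Set (c ⊔ ℓ)
  EventuallyLinearFrom e d k₀ = ∀ k → k₀ ≤ k → IsD k (d + k * e)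

  IsD₀ : ℕ → Set (c ⊔ ℓ)
  IsD₀ d = ∃[ e ] IsExponent e × (∃[ k₀ ] EventuallyLinearFrom e d k₀)

  Isk-D : ℕ → Set (c ⊔ ℓ)
  Isk-D k₀ = ∃[ e ] ∃[ d ] IsExponent e × IsD₀ d ×
    IsLeast (λ k → 1 ≤ k × EventuallyLinearFrom e d k) k₀

{-# OPTIONS --safe #-}
module Submission where

-- Upper bounds.  A term 0, or a pair of equal terms, is a zero-sum subsequence of
-- length at most 2, and the claimed values grow by at least 2 from k to k + 1.  So the
-- terms may be taken distinct and nonzero: they form a set S of points of PG(4,2).
-- If k ∈ {1, …, 5, 8}, split off a line of S when there is one; otherwise S is a cap,
-- and the caps are classified up to GL(5,2), adding one point at a time (there are none
-- with 17 points).  If k ∈ {6, 7, 9, 10}, the complement of S has at most 10 points, and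
-- the sets of that size are classified in the same way; for each of the orbits a packing
-- that avoids the representative is exhibited.  If k > 10, no such S exists.
--
-- Lower bounds.  Give the elements positive weights so that every nonempty zero-sum
-- subsequence of S has weight at least c.  If k disjoint ones exist, the remaining terms
-- weigh at most w(S) − kc and have the same sum as S.  The extremal S have so little
-- excess weight that at most one term could remain, while their sum is neither 0 nor one
-- of their terms.  Two weightings suffice: weight 1 off a hyperplane and 2 on it (c = 4,
-- for k ≤ 7), and weight 2 except for 3 on a single repeated point (c = 6, for k ≥ 8).

open import Defs
open import Algebra.Bundles using (AbelianGroup)
open import Data.Empty using (⊥)
open import Data.Fin.Base using (zero)
open import Data.List.Base using (List; []; _∷_; _++_; map; concat; foldr; length; filter; take; drop; replicate)
import Data.List.Membership.DecPropositional as DecMembership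
open import Data.List.Membership.Propositional using (_∈_; _∉_; find)
open import Data.List.Membership.Propositional.Properties using (∈-map⁺; ∈-map⁻; ∈-++⁺ˡ; ∈-++⁺ʳ; ∈-++⁻; ∈-∃++; ∈-filter⁺)
open import Data.List.Properties using (++-assoc; concat-map; length-++; length-map; length-replicate; length-take; map-++; map-cong; map-id; map-∘; take++drop≡id)
open import Data.List.Relation.Binary.Permutation.Propositional using (_↭_; refl; prep; swap; trans; ↭-reflexive; ↭-sym; ↭-trans; ↭⇒↭ₛ; ↭ₛ⇒↭)
open import Data.List.Relation.Binary.Permutation.Propositional.Properties using (∈-resp-↭; All-resp-↭; ↭-length; drop-∷; shift; shifts; ++⁺ʳ)
import Data.List.Relation.Binary.Permutation.Setoid as PermutationSetoid
import Data.List.Relation.Binary.Permutation.Setoid.Properties as Permutationₛ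
open import Data.List.Relation.Binary.Pointwise using (Pointwise; []; _∷_)
open import Data.List.Relation.Unary.All as All using (All; []; _∷_; all?)
import Data.List.Relation.Unary.All.Properties as All
open import Data.List.Relation.Unary.AllPairs using ([]; _∷_)
open import Data.List.Relation.Unary.Any using (Any; here; there; any?)
import Data.List.Relation.Unary.Unique.DecPropositional as DecUnique
open import Data.List.Relation.Unary.Unique.Propositional using (Unique)
import Data.List.Relation.Unary.Unique.Propositional.Properties as Unique
open import Data.Nat.Base using (ℕ; zero; suc; _+_; _*_; _^_; _/_; _%_; _≤_; _<_; z≤n; s≤s)
import Data.Nat.Properties as ℕ
open import Data.Parity.Base as ℙ using (Parity; 0ℙ; 1ℙ)
import Data.Parity.Properties as ℙ
open import Data.Product.Base using (_×_; _,_; proj₁; proj₂; ∃-syntax)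
open import Data.Sum.Base using (_⊎_; inj₁; inj₂)
open import Data.Unit.Base using (⊤)
open import Data.Vec.Base as Vec using (Vec; []; _∷_; lookup; tabulate)
import Data.Vec.Properties as Vec
open import Function.Base using (_∘_; id)
open import Relation.Binary.Definitions using (DecidableEquality)
open import Relation.Binary.PropositionalEquality using (_≡_; _≢_; refl; sym; cong; cong₂; subst; subst₂; module ≡-Reasoning)
import Relation.Binary.PropositionalEquality as ≡
open import Relation.Nullary using (Dec; yes; no; ¬_; ¬?; contradiction; _×-dec_; _⊎-dec_)
open import Relation.Nullary.Decidable using (True; toWitness; map′; decidable-stable)
open import Relation.Unary using (Decidable)

-- The group, as a set of vectors with propositional equality

V : Set
V = Vec Parity 5

infixl 6 _⊕_

_⊕_ : V → V → V
_⊕_ = Vec.zipWith ℙ._+_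

𝟎 : V
𝟎 = Vec.replicate 5 0ℙ

_≟_ : DecidableEquality V
_≟_ = Vec.≡-dec ℙ._≟_

open DecMembership _≟_ using (_∈?_)
open DecUnique _≟_ using (unique?)

⊕-assoc : ∀ x y z → (x ⊕ y) ⊕ z ≡ x ⊕ (y ⊕ z)
⊕-assoc = Vec.zipWith-assoc ℙ.+-assoc

⊕-comm : ∀ x y → x ⊕ y ≡ y ⊕ x
⊕-comm = Vec.zipWith-comm ℙ.+-comm

⊕-identityˡ : ∀ x → 𝟎 ⊕ x ≡ x
⊕-identityˡ = Vec.zipWith-identityˡ ℙ.+-identityˡ

⊕-identityʳ : ∀ x → x ⊕ 𝟎 ≡ x
⊕-identityʳ = Vec.zipWith-identityʳ ℙ.+-identityʳ

⊕-self : ∀ x → x ⊕ x ≡ 𝟎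
⊕-self x = ≡.trans (cong (_⊕ x) (sym (Vec.map-id x))) (Vec.zipWith-inverseˡ ℙ.p+p≡0ℙ x)

⊕-swap : ∀ x y z → x ⊕ (y ⊕ z) ≡ y ⊕ (x ⊕ z)
⊕-swap x y z = begin
  x ⊕ (y ⊕ z)  ≡⟨ ⊕-assoc x y z ⟨
  (x ⊕ y) ⊕ z  ≡⟨ cong (_⊕ z) (⊕-comm x y) ⟩
  (y ⊕ x) ⊕ z  ≡⟨ ⊕-assoc y x z ⟩
  y ⊕ (x ⊕ z)  ∎
  where open ≡-Reasoning

⊕-cancel : ∀ x y → x ⊕ (x ⊕ y) ≡ y
⊕-cancel x y = begin
  x ⊕ (x ⊕ y)  ≡⟨ ⊕-assoc x x y ⟨
  (x ⊕ x) ⊕ y  ≡⟨ cong (_⊕ y) (⊕-self x) ⟩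
  𝟎 ⊕ y        ≡⟨ ⊕-identityˡ y ⟩
  y            ∎
  where open ≡-Reasoning

x⊕y≡𝟎⇒x≡y : ∀ x y → x ⊕ y ≡ 𝟎 → x ≡ y
x⊕y≡𝟎⇒x≡y x y eq = begin
  x            ≡⟨ ⊕-identityʳ x ⟨
  x ⊕ 𝟎        ≡⟨ cong (x ⊕_) eq ⟨
  x ⊕ (x ⊕ y)  ≡⟨ ⊕-cancel x y ⟩
  y            ∎
  where open ≡-Reasoning

sum : List V → V
sum = foldr _⊕_ 𝟎

sum-++ : ∀ xs ys → sum (xs ++ ys) ≡ sum xs ⊕ sum ys
sum-++ []       ys = sym (⊕-identityˡ (sum ys))
sum-++ (x ∷ xs) ys = ≡.trans (cong (x ⊕_) (sum-++ xs ys)) (sym (⊕-assoc x (sum xs) (sum ys)))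

sum-↭ : ∀ {xs ys} → xs ↭ ys → sum xs ≡ sum ys
sum-↭ refl                 = refl
sum-↭ (prep x p)           = cong (x ⊕_) (sum-↭ p)
sum-↭ (swap {ys = ys} x y p) = ≡.trans (cong (λ s → x ⊕ (y ⊕ s)) (sum-↭ p)) (⊕-swap x y (sum ys))
sum-↭ (trans p q)          = ≡.trans (sum-↭ p) (sum-↭ q)

-- Points of PG(4,2), and sets of points as duplicate-free lists

allVecs : ∀ n → List (Vec Parity n)
allVecs zero    = [] ∷ []
allVecs (suc n) = map (0ℙ ∷_) (allVecs n) ++ map (1ℙ ∷_) (allVecs n)

∈-allVecs : ∀ {n} (x : Vec Parity n) → x ∈ allVecs n
∈-allVecs []       = here refl
∈-allVecs (0ℙ ∷ x) = ∈-++⁺ˡ (∈-map⁺ (0ℙ ∷_) (∈-allVecs x))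
∈-allVecs {suc n} (1ℙ ∷ x) = ∈-++⁺ʳ (map (0ℙ ∷_) (allVecs n)) (∈-map⁺ (1ℙ ∷_) (∈-allVecs x))

-- `allVecs` lists the zero vector first, so the 31 points of PG(4,2) remain.
nonzeros : List V
nonzeros = drop 1 (allVecs 5)

∈-nonzeros : ∀ {x} → x ≢ 𝟎 → x ∈ nonzeros
∈-nonzeros {x} x≢𝟎 with ∈-allVecs x
... | here x≡𝟎 = contradiction x≡𝟎 x≢𝟎
... | there x∈ = x∈

-- Induction on `L`: once its first element is removed from `S`, the later ones are still there,
-- being different from it. In this way blocks of distinct points become subsequences.
extract : ∀ {L S : List V} → Unique L → All (_∈ S) L → ∃[ R ] S ↭ L ++ R
extract {S = S} [] [] = S , refl
extract {x ∷ L} {S} (x∉L ∷ L!) (x∈S ∷ L⊆S) with ∈-∃++ x∈S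
... | as , bs , refl = let R , p = extract L! (All.zipWith remain (x∉L , L⊆S)) in
    R , ↭-trans S↭ (prep x p)
  where
  S↭ : S ↭ x ∷ as ++ bs
  S↭ = shift x as bs
  remain : ∀ {y} → x ≢ y × y ∈ S → y ∈ as ++ bs
  remain (x≢y , y∈S) with ∈-resp-↭ S↭ y∈S
  ... | here y≡x = contradiction (sym y≡x) x≢y
  ... | there y∈ = y∈

Unique-length-≤ : ∀ {L S} → Unique L → All (_∈ S) L → length L ≤ length S
Unique-length-≤ {L} L! L⊆S = let R , p = extract L! L⊆S in
  subst (length L ≤_) (sym (≡.trans (↭-length p) (length-++ L))) (ℕ.m≤m+n (length L) (length R))

Simple : List V → Set
Simple S = Unique S × All (_≢ 𝟎) S

simple? : Decidable Simple
simple? S = unique? S ×-dec all? (λ x → ¬? (x ≟ 𝟎)) S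

nonzeros-simple : Simple nonzeros
nonzeros-simple = toWitness {a? = simple? nonzeros} _

Simple-length-≤ : ∀ {S} → Simple S → length S ≤ 31
Simple-length-≤ (S! , S≢𝟎) = Unique-length-≤ S! (All.map ∈-nonzeros S≢𝟎)

-- Packings of disjoint zero-sum subsequences

ZeroSum : List V → Set
ZeroSum T = T ≢ [] × sum T ≡ 𝟎

-- The subsequences are split off one after another, with an arbitrary remainder at the end. This
-- suits the induction on `k`, where one of them is cut off and the bound for `k` handles the rest.
data Packing : ℕ → List V → Set where
  none : ∀ {S} → Packing 0 S
  cut  : ∀ {k S T R} → ZeroSum T → S ↭ T ++ R → Packing k R → Packing (suc k) S

Packing-++ : ∀ {k S} X → Packing k S → Packing k (S ++ X)
Packing-++ X none = none
Packing-++ X (cut {T = T} {R} z q P) =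
  cut z (↭-trans (++⁺ʳ X q) (↭-reflexive (++-assoc T R X))) (Packing-++ X P)

cutAll : ∀ Ts {S R} → All ZeroSum Ts → S ↭ concat Ts ++ R → Packing (length Ts) S
cutAll []       []       p = none
cutAll (T ∷ Ts) {R = R} (z ∷ zs) p =
  cut z (↭-trans p (↭-reflexive (++-assoc T (concat Ts) R))) (cutAll Ts zs refl)

-- Injective linear maps

-- Additivity is linearity over the field with two elements, so these are the elements of GL(5,2).
-- They carry orbit representatives into the set under consideration.
record Embedding : Set where
  field
    to   : V → V
    homo : ∀ x y → to (x ⊕ y) ≡ to x ⊕ to y
    inj  : ∀ {x y} → to x ≡ to y → x ≡ y

  to-𝟎 : to 𝟎 ≡ 𝟎
  to-𝟎 = ≡.trans (homo 𝟎 𝟎) (⊕-self (to 𝟎))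

  to-≢𝟎 : ∀ {x} → x ≢ 𝟎 → to x ≢ 𝟎
  to-≢𝟎 x≢𝟎 eq = x≢𝟎 (inj (≡.trans eq (sym to-𝟎)))

  to-sum : ∀ T → sum (map to T) ≡ to (sum T)
  to-sum []      = sym to-𝟎
  to-sum (x ∷ T) = ≡.trans (cong (to x ⊕_) (to-sum T)) (sym (homo x (sum T)))

  to-ZeroSum : ∀ {T} → ZeroSum T → ZeroSum (map to T)
  to-ZeroSum {[]}    (T≢[] , _) = contradiction refl T≢[]
  to-ZeroSum {x ∷ T} (_ , eq)   = (λ ()) , ≡.trans (to-sum (x ∷ T)) (≡.trans (cong to eq) to-𝟎)

  extract-image : ∀ {D S} → Unique D → All (λ x → to x ∈ S) D → ∃[ R ] S ↭ map to D ++ R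
  extract-image D! D⊆S = extract (Unique.map⁺ inj D!) (All.map⁺ D⊆S)

  preimage-length-≤ : ∀ {D S} → Unique D → All (λ x → to x ∈ S) D → length D ≤ length S
  preimage-length-≤ {D} {S} D! D⊆S =
    subst (_≤ length S) (length-map to D) (Unique-length-≤ (Unique.map⁺ inj D!) (All.map⁺ D⊆S))

  -- The image of `D` and the set `S` are disjoint sets of nonzero points, of which there are only
  -- 31.
  avoiding-length-≤ : ∀ {D S} → Simple D → Simple S → All (λ x → to x ∉ S) D → length D + length S ≤ 31
  avoiding-length-≤ {D} {S} (D! , D≢𝟎) (S! , S≢𝟎) D∩S =
    subst (_≤ 31) (≡.trans (length-++ (map to D)) (cong (_+ length S) (length-map to D)))
      (Simple-length-≤
        ( Unique.++⁺ (Unique.map⁺ inj D!) S!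
            (λ (y∈D , y∈S) → All.lookup (All.map⁺ {P = _∉ S} D∩S) y∈D y∈S)
        , All.++⁺ (All.map⁺ (All.map to-≢𝟎 D≢𝟎)) S≢𝟎))

open Embedding

idₑ : Embedding
idₑ = record { to = id ; homo = λ _ _ → refl ; inj = id }

_∘ₑ_ : Embedding → Embedding → Embedding
f ∘ₑ g = record
  { to   = to f ∘ to g
  ; homo = λ x y → ≡.trans (cong (to f) (homo g x y)) (homo f (to g x) (to g y))
  ; inj  = inj g ∘ inj f
  }

-- The matrix-vector product over the field with two elements, `M` being the columns.
apply : ∀ {n} → Vec V n → Vec Parity n → V
apply []      []       = 𝟎
apply (c ∷ M) (0ℙ ∷ x) = apply M x
apply (c ∷ M) (1ℙ ∷ x) = c ⊕ apply M x

apply-homo : ∀ {n} (M : Vec V n) x y → apply M (Vec.zipWith ℙ._+_ x y) ≡ apply M x ⊕ apply M y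
apply-homo []      []       []       = sym (⊕-self 𝟎)
apply-homo (c ∷ M) (0ℙ ∷ x) (0ℙ ∷ y) = apply-homo M x y
apply-homo (c ∷ M) (0ℙ ∷ x) (1ℙ ∷ y) =
  ≡.trans (cong (c ⊕_) (apply-homo M x y)) (⊕-swap c (apply M x) (apply M y))
apply-homo (c ∷ M) (1ℙ ∷ x) (0ℙ ∷ y) =
  ≡.trans (cong (c ⊕_) (apply-homo M x y)) (sym (⊕-assoc c (apply M x) (apply M y)))
apply-homo (c ∷ M) (1ℙ ∷ x) (1ℙ ∷ y) = begin
  apply M (Vec.zipWith ℙ._+_ x y)            ≡⟨ apply-homo M x y ⟩
  apply M x ⊕ apply M y                      ≡⟨ ⊕-cancel c _ ⟨
  c ⊕ (c ⊕ (apply M x ⊕ apply M y))          ≡⟨ cong (c ⊕_) (⊕-swap c (apply M x) (apply M y)) ⟩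
  c ⊕ (apply M x ⊕ (c ⊕ apply M y))          ≡⟨ ⊕-assoc c (apply M x) (c ⊕ apply M y) ⟨
  (c ⊕ apply M x) ⊕ (c ⊕ apply M y)          ∎
  where open ≡-Reasoning

-- extend makes the two occurrences of span M share one evaluation.
span : ∀ {n} → Vec V n → List V
span []      = 𝟎 ∷ []
span (c ∷ M) = extend (span M)
  where
  extend : List V → List V
  extend L = L ++ map (c ⊕_) L

apply∈span : ∀ {n} (M : Vec V n) x → apply M x ∈ span M
apply∈span []      []       = here refl
apply∈span (c ∷ M) (0ℙ ∷ x) = ∈-++⁺ˡ (apply∈span M x)
apply∈span (c ∷ M) (1ℙ ∷ x) = ∈-++⁺ʳ (span M) (∈-map⁺ (c ⊕_) (apply∈span M x))

Independent : ∀ {n} → Vec V n → Set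
Independent []      = ⊤
Independent (c ∷ M) = c ∉ span M × Independent M

independent? : ∀ {n} (M : Vec V n) → Dec (Independent M)
independent? []      = yes _
independent? (c ∷ M) = ¬? (c ∈? span M) ×-dec independent? M

-- A kernel vector with first coordinate 1 would express the first column by the later ones, against
-- independence.
kernel : ∀ {n} (M : Vec V n) → Independent M → ∀ x → apply M x ≡ 𝟎 → x ≡ Vec.replicate n 0ℙ
kernel []      _         []       _  = refl
kernel (c ∷ M) (_ , ind) (0ℙ ∷ x) eq = cong (0ℙ ∷_) (kernel M ind x eq)
kernel (c ∷ M) (c∉ , _)  (1ℙ ∷ x) eq =
  contradiction (subst (_∈ span M) (sym (x⊕y≡𝟎⇒x≡y c (apply M x) eq)) (apply∈span M x)) c∉

matrix : (M : Vec V 5) → Independent M → Embedding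
matrix M ind = record { to = apply M ; homo = apply-homo M ; inj = injective }
  where
  injective : ∀ {x y} → apply M x ≡ apply M y → x ≡ y
  injective {x} {y} eq = x⊕y≡𝟎⇒x≡y x y (kernel M ind (x ⊕ y)
    (≡.trans (apply-homo M x y) (≡.trans (cong (_⊕ apply M y) eq) (⊕-self (apply M y)))))

-- Climbing through the orbits, one point at a time

-- A node is a representative r with one move (x , M , j) for each relevant point x ∉ r:
-- the matrix with columns M maps the j-th representative of the next level into r ∪ {x}.
Move : Set
Move = V × Vec V 5 × ℕ

Node : Set
Node = List V × List Move

-- An index beyond the end of the list fails, so a move with an invalid target cannot pass the
-- check.
At : {A : Set} → ℕ → (A → Set) → List A → Set
At i       P []       = ⊥
At zero    P (a ∷ as) = P a
At (suc i) P (a ∷ as) = At i P as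

at? : ∀ {A : Set} i {P : A → Set} → Decidable P → Decidable (At i P)
at? i       P? []       = no id
at? zero    P? (a ∷ as) = P? a
at? (suc i) P? (a ∷ as) = at? i P? as

At⇒Any : ∀ {A : Set} i {P : A → Set} {as} → At i P as → Any P as
At⇒Any zero    {as = _ ∷ _} p = here p
At⇒Any (suc i) {as = _ ∷ _} p = there (At⇒Any i p)

-- Exit r x marks the points x by which r need not be extended.
module Climb (Exit : List V → V → Set) (exit? : ∀ r x → Dec (Exit r x)) where

  -- The matrix leads from the representative `r′` of the next level to `x ∷ r`, not back: composed
  -- with an embedding of `x ∷ r` into some set, it gives an embedding of `r′` into the same set.
  Transition : List Node → List V → Move → Set
  Transition next r (x , M , j) =
    Independent M × At j (λ (r′ , _) → All (λ y → apply M y ∈ x ∷ r) r′) next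

  transition? : ∀ next r → Decidable (Transition next r)
  transition? next r (x , M , j) =
    independent? M ×-dec at? j (λ (r′ , _) → all? (λ y → apply M y ∈? (x ∷ r)) r′) next

  Covers : List V → List V → Set
  Covers r xs = All (λ x → x ∈ r ⊎ Exit r x ⊎ x ∈ xs) nonzeros

  covers? : ∀ r xs → Dec (Covers r xs)
  covers? r xs = all? (λ x → (x ∈? r) ⊎-dec (exit? r x ⊎-dec (x ∈? xs))) nonzeros

  Step : List Node → Node → Set
  Step next (r , ts) = Covers r (map proj₁ ts) × All (Transition next r) ts

  step? : ∀ next → Decidable (Step next)
  step? next (r , ts) = covers? r (map proj₁ ts) ×-dec all? (transition? next r) ts

  WellFormed : ℕ → Node → Set
  WellFormed m (r , _) = Simple r × length r ≡ m

  wellFormed? : ∀ m → Decidable (WellFormed m)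
  wellFormed? m (r , _) = simple? r ×-dec (length r ℕ.≟ m)

  Chain : ℕ → List Node → List (List Node) → Set
  Chain m l []        = All (WellFormed m) l
  Chain m l (l′ ∷ ls) =
    All (WellFormed m) l × All (Step l′) l × Chain (suc m) l′ ls

  chain? : ∀ m l ls → Dec (Chain m l ls)
  chain? m l []        = all? (wellFormed? m) l
  chain? m l (l′ ∷ ls) =
    all? (wellFormed? m) l ×-dec all? (step? l′) l ×-dec chain? (suc m) l′ ls

  level : List Node → List (List Node) → ℕ → List Node
  level l ls        zero    = l
  level l []        (suc i) = []
  level l (l′ ∷ ls) (suc i) = level l′ ls i

  level-wellFormed : ∀ {m l ls} → Chain m l ls → ∀ i {ν} → ν ∈ level l ls i → WellFormed (m + i) ν
  level-wellFormed {m} {ls = []} wf zero ν∈ rewrite ℕ.+-identityʳ m = All.lookup wf ν∈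
  level-wellFormed {m} {ls = _ ∷ _} (wf , _) zero ν∈ rewrite ℕ.+-identityʳ m = All.lookup wf ν∈
  level-wellFormed {m} {ls = _ ∷ _} (_ , _ , ch) (suc i) ν∈ rewrite ℕ.+-suc m i =
    level-wellFormed ch i ν∈

  -- `large` expresses that `Q` holds at no fewer than `n` nonzero points: an embedded set of fewer
  -- points never exhausts it.
  module _ {Q : V → Set} (n : ℕ)
    (large : ∀ (f : Embedding) {r} → Simple r → length r < n → ∃[ x ] x ≢ 𝟎 × x ∉ r × Q (to f x))
    where

    Reached : List Node → Set
    Reached l = ∃[ f ] ∃[ ν ] ν ∈ l × All (λ x → Q (to f x)) (proj₁ ν)

    Exited : Set
    Exited = ∃[ f ] ∃[ r ] ∃[ x ] Exit r x × x ≢ 𝟎 × x ∉ r × All (λ y → Q (to f y)) (x ∷ r)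

    -- `large` supplies a further point `x` with `Q (to f x)`. Unless `x` is an exit, `Covers`
    -- provides a move for it, and the matrix of the move followed by `f` embeds a representative of
    -- the next level.
    advance : ∀ {m l l′} → All (WellFormed m) l → All (Step l′) l → suc m ≤ n →
              Reached l → Reached l′ ⊎ Exited
    advance wf st m<n (f , (r , ts) , ν∈l , Qr) with All.lookup wf ν∈l | All.lookup st ν∈l
    ... | r-simple , refl | cover , moves with large f r-simple m<n
    ...   | x , x≢𝟎 , x∉r , Qx with All.lookup cover (∈-nonzeros x≢𝟎)
    ...     | inj₁ x∈r            = contradiction x∈r x∉r
    ...     | inj₂ (inj₁ ex)      = inj₂ (f , r , x , ex , x≢𝟎 , x∉r , Qx ∷ Qr)
    ...     | inj₂ (inj₂ x∈ts) with ∈-map⁻ proj₁ x∈ts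
    ...       | (_ , M , j) , t∈ts , refl with All.lookup moves t∈ts
    ...         | ind , r′∈l′ with find (At⇒Any j r′∈l′)
    ...           | ν′ , ν′∈l′ , Mr′ =
      inj₁ (f ∘ₑ matrix M ind , ν′ , ν′∈l′ , All.map (All.lookup (Qx ∷ Qr)) Mr′)

    climb : ∀ i {m l ls} → Chain m l ls → i ≤ length ls → m + i ≤ n →
            Reached l → Reached (level l ls i) ⊎ Exited
    climb zero _ _ _ ρ = inj₁ ρ
    climb (suc i) {m} {l} {l′ ∷ ls} (wf , st , ch) (s≤s i≤) m+i≤n ρ
      with advance wf st (ℕ.≤-trans (s≤s (ℕ.m≤m+n m i)) 1+m+i≤n) ρ
      where
      1+m+i≤n : suc m + i ≤ n
      1+m+i≤n = subst (_≤ n) (ℕ.+-suc m i) m+i≤n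
    ... | inj₁ ρ′ = climb i ch i≤ (subst (_≤ n) (ℕ.+-suc m i) m+i≤n) ρ′
    ... | inj₂ ε  = inj₂ ε

-- Counting points outside a set; lines and blocks

-- This serves to establish `large`. If no point outside `r` satisfies `Q`, then `D` is the whole
-- complement of `r`, big enough for a counting argument to refute this case.
outside : ∀ {Q : V → Set} → Decidable Q → ∀ r →
          (∃[ x ] x ≢ 𝟎 × x ∉ r × Q x) ⊎
          (∃[ D ] Simple D × 31 ≤ length r + length D × All (¬_ ∘ Q) D)
outside {Q} Q? r with any? (λ x → ¬? (x ∈? r) ×-dec Q? x) nonzeros
... | yes found = let x , x∈ , x∉r , Qx = find found in
    inj₁ (x , All.lookup (proj₂ nonzeros-simple) x∈ , x∉r , Qx)
... | no ¬found =
    inj₂ ( D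
         , (Unique.filter⁺ out? (proj₁ nonzeros-simple) , All.filter⁺ out? (proj₂ nonzeros-simple))
         , big
         , All.zipWith (λ (x∉r , ¬both) Qx → ¬both (x∉r , Qx))
             (All.all-filter out? nonzeros , All.filter⁺ out? (All.¬Any⇒All¬ nonzeros ¬found)))
  where
  out? : Decidable (_∉ r)
  out? x = ¬? (x ∈? r)
  D : List V
  D = filter out? nonzeros
  split : ∀ {x} → x ∈ nonzeros → x ∈ r ++ D
  split {x} x∈ with x ∈? r
  ... | yes x∈r = ∈-++⁺ˡ x∈r
  ... | no  x∉r = ∈-++⁺ʳ r (∈-filter⁺ out? x∈ x∉r)
  big : 31 ≤ length r + length D
  big = subst (31 ≤_) (length-++ r) (Unique-length-≤ (proj₁ nonzeros-simple) (All.tabulate split))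

-- For nonzero `x`, the points `x`, `y` and `x ⊕ y` form a line of PG(4,2), and their sum is zero.
-- With this exit, a cap is extended only to caps.
Collinear : List V → V → Set
Collinear r x = Any (λ y → x ⊕ y ∈ r) r

collinear? : ∀ r x → Dec (Collinear r x)
collinear? r x = any? (λ y → (x ⊕ y) ∈? r) r

module Caps = Climb Collinear collinear?
module Sets = Climb (λ _ _ → ⊥) (λ _ _ → no id)

-- A decidable certificate: as all points of all blocks are distinct, the blocks are disjoint
-- subsequences of every sequence in which these points occur.
Blocks : ℕ → (V → Set) → List (List V) → Set
Blocks k P Ts = length Ts ≡ k × All ZeroSum Ts × Unique (concat Ts) × All P (concat Ts)

blocks? : ∀ k {P} → Decidable P → Decidable (Blocks k P)
blocks? k P? Ts =
  (length Ts ℕ.≟ k) ×-dec all? zeroSum? Ts ×-dec unique? (concat Ts) ×-dec all? P? (concat Ts)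
  where
  zeroSum? : Decidable ZeroSum
  zeroSum? []      = no λ (T≢[] , _) → T≢[] refl
  zeroSum? (x ∷ T) = map′ ((λ ()) ,_) proj₂ (sum (x ∷ T) ≟ 𝟎)

Blocks⇒Packing : ∀ {k P S} (f : Embedding) → (∀ {x} → P x → to f x ∈ S) →
                 ∀ {Ts} → Blocks k P Ts → Packing k S
Blocks⇒Packing {S = S} f P⇒ {Ts} (refl , zs , Ts! , PTs) =
  let R , p = extract-image f Ts! (All.map P⇒ PTs) in
  subst (λ k → Packing k S) (length-map (map (to f)) Ts)
    (cutAll (map (map (to f)) Ts) (All.map⁺ (All.map (to-ZeroSum f) zs))
      (↭-trans p (↭-reflexive (cong (_++ R) (sym (concat-map Ts))))))

-- Any entry of `Ps` may serve a representative, so one packing can settle several orbits.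
AllPacked : ℕ → (List V → V → Set) → List Node → List (List (List V)) → Set
AllPacked k P l Ps = All (λ (r , _) → Any (Blocks k (P r)) Ps) l

allPacked? : ∀ k {P} → (∀ r → Decidable (P r)) → ∀ l Ps → Dec (AllPacked k P l Ps)
allPacked? k P? l Ps = all? (λ (r , _) → any? (blocks? k (P? r)) Ps) l

-- Upper bounds: from k to k + 1

Upper : ℕ → ℕ → Set
Upper k n = ∀ S → n ≤ length S → Packing k S

Upper-mono : ∀ {k m n} → m ≤ n → Upper k m → Upper k n
Upper-mono m≤n U S n≤ = U S (ℕ.≤-trans m≤n n≤)

simple-or-short : ∀ S → Simple S ⊎ (∃[ T ] ∃[ R ] ZeroSum T × length T ≤ 2 × S ↭ T ++ R)
simple-or-short [] = inj₁ ([] , [])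
simple-or-short (x ∷ S) with x ≟ 𝟎 | x ∈? S
... | yes x≡𝟎 | _ = inj₂ (x ∷ [] , S , ((λ ()) , ≡.trans (⊕-identityʳ x) x≡𝟎) , s≤s z≤n , refl)
... | no x≢𝟎 | yes x∈S = let as , bs , eq = ∈-∃++ x∈S in
  inj₂ ( x ∷ x ∷ [] , as ++ bs
       , ((λ ()) , ≡.trans (cong (x ⊕_) (⊕-identityʳ x)) (⊕-self x))
       , s≤s (s≤s z≤n)
       , prep x (↭-trans (↭-reflexive eq) (shift x as bs)))
... | no x≢𝟎 | no x∉S with simple-or-short S
...   | inj₁ (S! , S≢𝟎) = inj₁ (All.¬Any⇒All¬ S x∉S ∷ S! , x≢𝟎 ∷ S≢𝟎)
...   | inj₂ (T , R , z , T≤2 , p) =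
  inj₂ (T , x ∷ R , z , T≤2 , ↭-trans (prep x p) (↭-sym (shift x T R)))

cut-short : ∀ {k n m S T R} → Upper k n → m + n ≤ length S → ZeroSum T → length T ≤ m →
            S ↭ T ++ R → Packing (suc k) S
cut-short {n = n} {m} {S} {T} {R} U m+n≤S z T≤m p =
  cut z p (U R (ℕ.+-cancelˡ-≤ m n (length R) m+n≤m+R))
  where
  open ℕ.≤-Reasoning
  m+n≤m+R : m + n ≤ m + length R
  m+n≤m+R = begin
    m + n                ≤⟨ m+n≤S ⟩
    length S             ≡⟨ ↭-length p ⟩
    length (T ++ R)      ≡⟨ length-++ T ⟩
    length T + length R  ≤⟨ ℕ.+-monoˡ-≤ (length R) T≤m ⟩
    m + length R         ∎

-- If `S` is not a set of points, at most two terms are cut off and at least `n` remain for the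
-- bound for `k`.
from-simple : ∀ {k n} → Upper k n → (∀ S → Simple S → 2 + n ≤ length S → Packing (suc k) S) →
              Upper (suc k) (2 + n)
from-simple U simple S 2+n≤S with simple-or-short S
... | inj₁ S-simple = simple S S-simple 2+n≤S
... | inj₂ (T , R , z , T≤2 , p) = cut-short U 2+n≤S z T≤2 p

-- `x` differs from `y` and `x ⊕ y` because these lie in `r`, and `y` differs from `x ⊕ y` because
-- `x` is nonzero.
line : ∀ {r x} → Collinear r x → x ≢ 𝟎 → x ∉ r →
       ∃[ T ] length T ≡ 3 × ZeroSum T × Unique T × All (_∈ x ∷ r) T
line {r} {x} col x≢𝟎 x∉r with find col
... | y , y∈r , x⊕y∈r =
  x ∷ y ∷ x ⊕ y ∷ [] , refl
  , ((λ ()) , ≡.trans (cong (λ z → x ⊕ (y ⊕ z)) (⊕-identityʳ (x ⊕ y)))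
      (≡.trans (sym (⊕-assoc x y (x ⊕ y))) (⊕-self (x ⊕ y))))
  , ((λ { refl → x∉r y∈r }) ∷ (λ x≡ → x∉r (subst (_∈ r) (sym x≡) x⊕y∈r)) ∷ [])
    ∷ (y≢x⊕y ∷ []) ∷ [] ∷ []
  , here refl ∷ there y∈r ∷ there x⊕y∈r ∷ []
  where
  open ≡-Reasoning
  y≢x⊕y : y ≢ x ⊕ y
  y≢x⊕y y≡x⊕y = x≢𝟎 (begin
    x            ≡⟨ ⊕-cancel y x ⟨
    y ⊕ (y ⊕ x)  ≡⟨ cong (y ⊕_) (⊕-comm y x) ⟩
    y ⊕ (x ⊕ y)  ≡⟨ cong (y ⊕_) y≡x⊕y ⟨
    y ⊕ y        ≡⟨ ⊕-self y ⟩
    𝟎            ∎)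

Inside Avoiding : List V → V → Set
Inside r x = x ∈ r
Avoiding r x = x ≢ 𝟎 × x ∉ r

-- The climb starts at the empty set. Either it reaches level `i`, where every representative
-- contains `suc k` blocks, or it meets a line in `S`; cutting off that line leaves `n` terms for
-- the bound for `k`.
cap-bound : ∀ {ts ls} → Caps.Chain 0 (([] , ts) ∷ []) ls →
            ∀ {k n} i {Ps} → i ≤ length ls → i ≤ 3 + n →
            AllPacked (suc k) Inside (Caps.level (([] , ts) ∷ []) ls i) Ps →
            Upper k n → Upper (suc k) (3 + n)
-- A line costs three terms while `from-simple` allows for two, so for its purpose the bound for `k`
-- is weakened from `n` to `n + 1`.
cap-bound chain {k} {n} i i≤ls i≤n packed U = from-simple (Upper-mono (ℕ.n≤1+n n) U) simple
  where
  simple : ∀ S → Simple S → 3 + n ≤ length S → Packing (suc k) S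
  simple S S-simple n≤S = finish
      (Caps.climb {Q = _∈ S} (length S) large i chain i≤ls (ℕ.≤-trans i≤n n≤S)
        (idₑ , _ , here refl , []))
    where
    large : ∀ (f : Embedding) {r} → Simple r → length r < length S →
            ∃[ x ] x ≢ 𝟎 × x ∉ r × to f x ∈ S
    large f {r} _ r<S with outside (λ x → to f x ∈? S) r
    ... | inj₁ found = found
    -- The image of `D` misses `S`, so `D` has at most 31 - |S| points; this forces |r| ≥ |S|.
    ... | inj₂ (D , D-simple , 31≤ , D∩S) = contradiction
      (ℕ.≤-trans (ℕ.+-monoˡ-≤ (length D) r<S)
        (subst (_≤ 31) (ℕ.+-comm (length D) (length S))
          (avoiding-length-≤ f D-simple S-simple D∩S)))
      (ℕ.<⇒≱ (s≤s 31≤))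
    finish : _ → Packing (suc k) S
    finish (inj₁ (f , ν , ν∈ , r⊆S)) =
      let _ , _ , Ts-ok = find (All.lookup packed ν∈) in
      Blocks⇒Packing f (All.lookup r⊆S) Ts-ok
    finish (inj₂ (f , r , x , col , x≢𝟎 , x∉r , xr⊆S)) =
      let T , |T|≡3 , z , T! , T⊆ = line col x≢𝟎 x∉r
          R , p = extract-image f T! (All.map (All.lookup xr⊆S) T⊆)
      in cut-short U n≤S (to-ZeroSum f z) (ℕ.≤-reflexive (≡.trans (length-map (to f) T) |T|≡3)) p

-- Here the climb takes place in the complement of `S`, which has `i` points when `S` has `2 + n`.
-- As `Sets` has no exits, level `i` is always reached.
complement-bound : ∀ {ts ls} → Sets.Chain 0 (([] , ts) ∷ []) ls →
                   ∀ {k n} i {Ps} → i ≤ length ls → i + (2 + n) ≡ 31 →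
                   AllPacked (suc k) Avoiding (Sets.level (([] , ts) ∷ []) ls i) Ps →
                   Upper k n → Upper (suc k) (2 + n)
complement-bound chain {k} {n} i i≤ls i+n≡31 packed U = from-simple U simple
  where
  exact : ∀ S → Simple S → length S ≡ 2 + n → Packing (suc k) S
  exact S S-simple S≡n = finish
      (Sets.climb {Q = _∉ S} i large i chain i≤ls ℕ.≤-refl (idₑ , _ , here refl , []))
    where
    i+S≡31 : i + length S ≡ 31
    i+S≡31 = ≡.trans (cong (i +_) S≡n) i+n≡31
    large : ∀ (f : Embedding) {r} → Simple r → length r < i → ∃[ x ] x ≢ 𝟎 × x ∉ r × to f x ∉ S
    large f {r} _ r<i with outside (λ x → ¬? (to f x ∈? S)) r
    ... | inj₁ found = found
    -- If `f` sent every point outside `r` into `S`, then |D| ≤ |S| = 31 - i; together with |r| < i,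
    -- fewer than 31 points would be accounted for.
    ... | inj₂ (D , D-simple , 31≤ , D⊆S) = contradiction
      (ℕ.≤-trans (s≤s 31≤) (ℕ.≤-trans (ℕ.+-mono-≤ r<i
        (preimage-length-≤ f (proj₁ D-simple) (All.map (decidable-stable (_ ∈? S)) D⊆S)))
        (ℕ.≤-reflexive i+S≡31)))
      ℕ.1+n≰n
    finish : _ → Packing (suc k) S
    finish (inj₁ (f , (r , ts) , ν∈ , r∩S)) =
      let _ , _ , Ts-ok = find (All.lookup packed ν∈) in
      Blocks⇒Packing f avoid⇒∈ Ts-ok
      where
      r-ok : Simple r × length r ≡ i
      r-ok = Sets.level-wellFormed chain i ν∈
      -- The embedded representative has as many points as the complement of `S` and therefore fills
      -- it; one more point outside `S` would make 32 nonzero points.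
      avoid⇒∈ : ∀ {x} → Avoiding r x → to f x ∈ S
      avoid⇒∈ {x} (x≢𝟎 , x∉r) with to f x ∈? S
      ... | yes x∈S = x∈S
      ... | no  x∉S = contradiction
        (subst (_≤ 31) (≡.trans (cong (λ j → suc j + length S) (proj₂ r-ok)) (cong suc i+S≡31))
          (avoiding-length-≤ f (All.¬Any⇒All¬ r x∉r ∷ proj₁ (proj₁ r-ok) , x≢𝟎 ∷ proj₂ (proj₁ r-ok))
            S-simple (x∉S ∷ r∩S)))
        ℕ.1+n≰n
  simple : ∀ S → Simple S → 2 + n ≤ length S → Packing (suc k) S
  -- Truncating `S` gives its complement exactly `i` points; the dropped terms join the remainder of
  -- the packing.
  simple S (S! , S≢𝟎) n≤S = subst (Packing (suc k)) (take++drop≡id (2 + n) S)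
    (Packing-++ (drop (2 + n) S) (exact (take (2 + n) S)
      (Unique.take⁺ (2 + n) S! , All.take⁺ (2 + n) S≢𝟎)
      (≡.trans (length-take (2 + n) S) (ℕ.m≤n⇒m⊓n≡m n≤S))))

-- There are only 31 points, so the case of distinct nonzero terms is void.
beyond-bound : ∀ {k n} → 31 < 2 + n → Upper k n → Upper (suc k) (2 + n)
beyond-bound 31<n U = from-simple U λ S S-simple n≤S →
  contradiction (ℕ.≤-trans (ℕ.≤-trans 31<n n≤S) (Simple-length-≤ S-simple)) ℕ.1+n≰n

-- The orbit tables

-- A point is coded by the number whose binary digits are its coordinates, the least
-- significant digit first.
bits : ∀ n → ℕ → Vec Parity n
bits zero    c = []
bits (suc n) c = bit (c % 2) ∷ bits n (c / 2)
  where
  bit : ℕ → Parity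
  bit zero    = 0ℙ
  bit (suc _) = 1ℙ

points : List ℕ → List V
points = map (bits 5)

columns : ∀ n → ℕ → Vec V n
columns zero    c = []
columns (suc n) c = bits 5 (c % 32) ∷ columns n (c / 32)

-- In base 32, least significant digit first, a move is coded by its point, the five
-- columns of its matrix and its target.
moves : List ℕ → List Move
moves = map λ c → bits 5 (c % 32) , columns 5 (c / 32) , c / 32 ^ 6

node : List ℕ → List ℕ → Node
node r cs = points r , moves cs

-- All points are equivalent under GL(5,2): each of the 31 moves from the empty set leads to the
-- single node with point 1.
cap-root : List Move
cap-root = moves
  (545392673 ∷ 545391682 ∷ 545391715 ∷ 545326212 ∷ 545326245 ∷ 545326278 ∷ 545326311 ∷ 541132040
   ∷ 541132073 ∷ 541132106 ∷ 541132139 ∷ 541132172 ∷ 541132205 ∷ 541132238 ∷ 541132271 ∷ 272696848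
   ∷ 272696881 ∷ 272696914 ∷ 272696947 ∷ 272696980 ∷ 272697013 ∷ 272697046 ∷ 272697079 ∷ 272697112
   ∷ 272697145 ∷ 272697178 ∷ 272697211 ∷ 272697244 ∷ 272697277 ∷ 272697310 ∷ 272697343 ∷ [])

cap-levels : List (List Node)
cap-levels =
  ( node (1 ∷ [])
      (545392674 ∷ 545393699 ∷ 545329188 ∷ 545330213 ∷ 545331238 ∷ 545332263 ∷ 541138984 ∷ 541140009
       ∷ 541141034 ∷ 541142059 ∷ 541143084 ∷ 541144109 ∷ 541145134 ∷ 541146159 ∷ 272711728
       ∷ 272712753 ∷ 272713778 ∷ 272714803 ∷ 272715828 ∷ 272716853 ∷ 272717878 ∷ 272718903
       ∷ 272719928 ∷ 272720953 ∷ 272721978 ∷ 272723003 ∷ 272724028 ∷ 272725053 ∷ 272726078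
       ∷ 272727103 ∷ [])
  ∷ []) ∷
  ( node (1 ∷ 2 ∷ [])
      (545392676 ∷ 545425445 ∷ 545458214 ∷ 545490983 ∷ 541329448 ∷ 541362217 ∷ 541394986 ∷ 541427755
       ∷ 541460524 ∷ 541493293 ∷ 541526062 ∷ 541558831 ∷ 273156144 ∷ 273188913 ∷ 273221682
       ∷ 273254451 ∷ 273287220 ∷ 273319989 ∷ 273352758 ∷ 273385527 ∷ 273418296 ∷ 273451065
       ∷ 273483834 ∷ 273516603 ∷ 273549372 ∷ 273582141 ∷ 273614910 ∷ 273647679 ∷ [])
  ∷ []) ∷
  ( node (1 ∷ 2 ∷ 4 ∷ [])
      (545392679 ∷ 1619134504 ∷ 1620183081 ∷ 1621231658 ∷ 1622280235 ∷ 1623328812 ∷ 1624377389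
       ∷ 1625425966 ∷ 1626474543 ∷ 1359087664 ∷ 1360136241 ∷ 1361184818 ∷ 1362233395 ∷ 1363281972
       ∷ 1364330549 ∷ 1365379126 ∷ 1366427703 ∷ 1367476280 ∷ 1368524857 ∷ 1369573434 ∷ 1370622011
       ∷ 1371670588 ∷ 1372719165 ∷ 1373767742 ∷ 1374816319 ∷ [])
  ∷ []) ∷
  ( node (1 ∷ 2 ∷ 4 ∷ 7 ∷ [])
      (545392680 ∷ 546441257 ∷ 547489834 ∷ 548538411 ∷ 549586988 ∷ 550635565 ∷ 551684142 ∷ 552732719
       ∷ 285345840 ∷ 286394417 ∷ 287442994 ∷ 288491571 ∷ 289540148 ∷ 290588725 ∷ 291637302
       ∷ 292685879 ∷ 293734456 ∷ 294783033 ∷ 295831610 ∷ 296880187 ∷ 297928764 ∷ 298977341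
       ∷ 300025918 ∷ 301074495 ∷ [])
  ∷ node (1 ∷ 2 ∷ 4 ∷ 8 ∷ [])
      (545392679 ∷ 541329451 ∷ 539234349 ∷ 538185806 ∷ 1619134511 ∷ 2692876336 ∷ 2726430769
       ∷ 2759985202 ∷ 2793539635 ∷ 2827094068 ∷ 2860648501 ∷ 2894202934 ∷ 2927757367 ∷ 2961311800
       ∷ 2994866233 ∷ 3028420666 ∷ 3061975099 ∷ 3095529532 ∷ 3129083965 ∷ 3162638398 ∷ 3196192831
       ∷ [])
  ∷ []) ∷
  ( node (1 ∷ 2 ∷ 4 ∷ 7 ∷ 8 ∷ [])
      (545392683 ∷ 545329197 ∷ 545332270 ∷ 1619134512 ∷ 1652688945 ∷ 1686243378 ∷ 1719797811
       ∷ 1753352244 ∷ 1786906677 ∷ 1820461110 ∷ 1854015543 ∷ 1887569976 ∷ 1921124409 ∷ 1954678842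
       ∷ 1988233275 ∷ 2021787708 ∷ 2055342141 ∷ 2088896574 ∷ 2122451007 ∷ [])
  ∷ node (1 ∷ 2 ∷ 4 ∷ 8 ∷ 15 ∷ [])
      (2692876336 ∷ 2726430769 ∷ 2759985202 ∷ 2793539635 ∷ 2827094068 ∷ 2860648501 ∷ 2894202934
       ∷ 2927757367 ∷ 2961311800 ∷ 2994866233 ∷ 3028420666 ∷ 3061975099 ∷ 3095529532 ∷ 3129083965
       ∷ 3162638398 ∷ 3196192831 ∷ [])
  ∷ node (1 ∷ 2 ∷ 4 ∷ 8 ∷ 16 ∷ [])
      (1619134503 ∷ 1615071275 ∷ 1612976173 ∷ 1611927630 ∷ 2692876335 ∷ 1346897971 ∷ 1344802869
       ∷ 1343754326 ∷ 2432829495 ∷ 1210589241 ∷ 1209540698 ∷ 2298742843 ∷ 1142431900 ∷ 2231636029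
       ∷ 2198081630 ∷ 3766618175 ∷ [])
  ∷ []) ∷
  ( node (1 ∷ 2 ∷ 4 ∷ 7 ∷ 8 ∷ 11 ∷ [])
      (545392685 ∷ 548538414 ∷ 1619134512 ∷ 1652688945 ∷ 1686243378 ∷ 1719797811 ∷ 1753352244
       ∷ 1786906677 ∷ 1820461110 ∷ 1854015543 ∷ 1887569976 ∷ 1921124409 ∷ 1954678842 ∷ 1988233275
       ∷ 2021787708 ∷ 2055342141 ∷ 2088896574 ∷ 2122451007 ∷ [])
  ∷ node (1 ∷ 2 ∷ 4 ∷ 7 ∷ 8 ∷ 16 ∷ [])
      (1619134507 ∷ 1619071021 ∷ 1619074094 ∷ 1359087667 ∷ 1359024181 ∷ 1359027254 ∷ 2692876345
       ∷ 2692875354 ∷ 3766618171 ∷ 2692809884 ∷ 3766554685 ∷ 3766557758 ∷ 2692809983 ∷ [])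
  ∷ node (1 ∷ 2 ∷ 4 ∷ 8 ∷ 15 ∷ 16 ∷ [])
      (3494381619 ∷ 3492286517 ∷ 3491237974 ∷ 3289922839 ∷ 3358072889 ∷ 3357024346 ∷ 3289922715
       ∷ 3289915548 ∷ 3357031517 ∷ 3358080062 ∷ [])
  ∷ node (1 ∷ 2 ∷ 4 ∷ 8 ∷ 16 ∷ 31 ∷ [])
      (2692809959 ∷ 2688615787 ∷ 2686584237 ∷ 2284324302 ∷ 2420180595 ∷ 2418149045 ∷ 2284062422
       ∷ 2284062521 ∷ 2418149210 ∷ 2420180892 ∷ [])
  ∷ []) ∷
  ( node (1 ∷ 2 ∷ 4 ∷ 7 ∷ 8 ∷ 11 ∷ 13 ∷ [])
      (545392686 ∷ 1619134512 ∷ 1652688945 ∷ 1686243378 ∷ 1719797811 ∷ 1753352244 ∷ 1786906677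
       ∷ 1820461110 ∷ 1854015543 ∷ 1887569976 ∷ 1921124409 ∷ 1954678842 ∷ 1988233275 ∷ 2021787708
       ∷ 2055342141 ∷ 2088896574 ∷ 2122451007 ∷ [])
  ∷ node (1 ∷ 2 ∷ 4 ∷ 7 ∷ 8 ∷ 11 ∷ 16 ∷ [])
      (1619134509 ∷ 1622280238 ∷ 2692876339 ∷ 3766618165 ∷ 3766716470 ∷ 3762554937 ∷ 3762653242
       ∷ 3759414428 ∷ 4840359997 ∷ 4843505726 ∷ 3759512735 ∷ [])
  ∷ node (1 ∷ 2 ∷ 4 ∷ 7 ∷ 8 ∷ 16 ∷ 25 ∷ [])
      (3762554923 ∷ 3760459821 ∷ 3760462894 ∷ 3494381619 ∷ 3492286517 ∷ 3492289590 ∷ 3494676538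
       ∷ 3492581436 ∷ 3492584511 ∷ [])
  ∷ node (1 ∷ 2 ∷ 4 ∷ 7 ∷ 8 ∷ 16 ∷ 27 ∷ [])
      (4840296493 ∷ 4840299566 ∷ 4580249653 ∷ 4580252726 ∷ 4591787069 ∷ 4591783998 ∷ [])
  ∷ []) ∷
  ( node (1 ∷ 2 ∷ 4 ∷ 7 ∷ 8 ∷ 11 ∷ 13 ∷ 14 ∷ [])
      (545392688 ∷ 578947121 ∷ 612501554 ∷ 646055987 ∷ 679610420 ∷ 713164853 ∷ 746719286 ∷ 780273719
       ∷ 813828152 ∷ 847382585 ∷ 880937018 ∷ 914491451 ∷ 948045884 ∷ 981600317 ∷ 1015154750
       ∷ 1048709183 ∷ [])
  ∷ node (1 ∷ 2 ∷ 4 ∷ 7 ∷ 8 ∷ 11 ∷ 13 ∷ 16 ∷ [])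
      (545392686 ∷ 1619134515 ∷ 1619071029 ∷ 1622219830 ∷ 1614880825 ∷ 1618029626 ∷ 1618097212
       ∷ 2692876350 ∷ 1618097247 ∷ [])
  ∷ node (1 ∷ 2 ∷ 4 ∷ 7 ∷ 8 ∷ 11 ∷ 16 ∷ 19 ∷ [])
      (1619134509 ∷ 1622280238 ∷ 1359087669 ∷ 1362233398 ∷ 1225001017 ∷ 1228146746 ∷ 1124342940
       ∷ 3766618173 ∷ 3867281470 ∷ 1127488671 ∷ [])
  ∷ node (1 ∷ 2 ∷ 4 ∷ 7 ∷ 8 ∷ 11 ∷ 16 ∷ 21 ∷ [])
      (1619071021 ∷ 1622216750 ∷ 1359087667 ∷ 1364330550 ∷ 4840359993 ∷ 4843505722 ∷ 5008132156
       ∷ 5011277887 ∷ [])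
  ∷ node (1 ∷ 2 ∷ 4 ∷ 7 ∷ 8 ∷ 11 ∷ 16 ∷ 29 ∷ [])
      (2696022062 ∷ 3766618163 ∷ 4202825790 ∷ [])
  ∷ []) ∷
  ( node (1 ∷ 2 ∷ 4 ∷ 7 ∷ 8 ∷ 11 ∷ 13 ∷ 14 ∷ 16 ∷ [])
      (545392691 ∷ 545329205 ∷ 545332278 ∷ 541139001 ∷ 541142074 ∷ 541144124 ∷ 541145151 ∷ [])
  ∷ node (1 ∷ 2 ∷ 4 ∷ 7 ∷ 8 ∷ 11 ∷ 13 ∷ 16 ∷ 19 ∷ [])
      (545392686 ∷ 1619134517 ∷ 1719797814 ∷ 1615071289 ∷ 1715734586 ∷ 1611930780 ∷ 1712594079 ∷ [])
  -- An empty list of moves marks a complete cap: each point outside it lies on a line through two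
  -- of its points.
  ∷ node (1 ∷ 2 ∷ 4 ∷ 7 ∷ 8 ∷ 11 ∷ 13 ∷ 16 ∷ 30 ∷ []) []
  ∷ node (1 ∷ 2 ∷ 4 ∷ 7 ∷ 8 ∷ 11 ∷ 16 ∷ 19 ∷ 29 ∷ [])
      (2692876350 ∷ [])
  ∷ node (1 ∷ 2 ∷ 4 ∷ 7 ∷ 8 ∷ 11 ∷ 16 ∷ 21 ∷ 25 ∷ [])
      (1612976173 ∷ 1612029006 ∷ 1346897971 ∷ 1343921302 ∷ 1209838874 ∷ 1142740508 ∷ 3766618175
       ∷ [])
  ∷ []) ∷
  ( node (1 ∷ 2 ∷ 4 ∷ 7 ∷ 8 ∷ 11 ∷ 13 ∷ 14 ∷ 16 ∷ 19 ∷ [])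
      (545392693 ∷ 646055990 ∷ 541329465 ∷ 641992762 ∷ 541493308 ∷ 642156607 ∷ [])
  ∷ node (1 ∷ 2 ∷ 4 ∷ 7 ∷ 8 ∷ 11 ∷ 13 ∷ 16 ∷ 19 ∷ 21 ∷ [])
      (545392686 ∷ 285345846 ∷ 1619134521 ∷ 1722942554 ∷ 1792083100 ∷ 1792083199 ∷ [])
  ∷ node (1 ∷ 2 ∷ 4 ∷ 7 ∷ 8 ∷ 11 ∷ 16 ∷ 19 ∷ 29 ∷ 30 ∷ []) []
  ∷ node (1 ∷ 2 ∷ 4 ∷ 7 ∷ 8 ∷ 11 ∷ 16 ∷ 21 ∷ 25 ∷ 31 ∷ [])
      (1924269485 ∷ 2122450382 ∷ 1934689907 ∷ 2130773718 ∷ 2130773850 ∷ 1934690204 ∷ [])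
  ∷ []) ∷
  ( node (1 ∷ 2 ∷ 4 ∷ 7 ∷ 8 ∷ 11 ∷ 13 ∷ 14 ∷ 16 ∷ 19 ∷ 21 ∷ [])
      (545392694 ∷ 1619134521 ∷ 1622280250 ∷ 1624377404 ∷ 1625425983 ∷ [])
  ∷ node (1 ∷ 2 ∷ 4 ∷ 7 ∷ 8 ∷ 11 ∷ 13 ∷ 16 ∷ 19 ∷ 21 ∷ 25 ∷ [])
      (1619134510 ∷ 1359087670 ∷ 1225001018 ∷ 1157894204 ∷ 1161141311 ∷ [])
  ∷ []) ∷
  ( node (1 ∷ 2 ∷ 4 ∷ 7 ∷ 8 ∷ 11 ∷ 13 ∷ 14 ∷ 16 ∷ 19 ∷ 21 ∷ 22 ∷ [])
      (545392697 ∷ 646055994 ∷ 713164860 ∷ 746719295 ∷ [])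
  ∷ node (1 ∷ 2 ∷ 4 ∷ 7 ∷ 8 ∷ 11 ∷ 13 ∷ 14 ∷ 16 ∷ 19 ∷ 21 ∷ 25 ∷ [])
      (545392694 ∷ 541329466 ∷ 539234364 ∷ 639999039 ∷ [])
  ∷ []) ∷
  ( node (1 ∷ 2 ∷ 4 ∷ 7 ∷ 8 ∷ 11 ∷ 13 ∷ 14 ∷ 16 ∷ 19 ∷ 21 ∷ 22 ∷ 25 ∷ [])
      (545392698 ∷ 545329212 ∷ 545332287 ∷ [])
  ∷ []) ∷
  ( node (1 ∷ 2 ∷ 4 ∷ 7 ∷ 8 ∷ 11 ∷ 13 ∷ 14 ∷ 16 ∷ 19 ∷ 21 ∷ 22 ∷ 25 ∷ 26 ∷ [])
      (545392700 ∷ 646055999 ∷ [])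
  ∷ []) ∷
  ( node (1 ∷ 2 ∷ 4 ∷ 7 ∷ 8 ∷ 11 ∷ 13 ∷ 14 ∷ 16 ∷ 19 ∷ 21 ∷ 22 ∷ 25 ∷ 26 ∷ 28 ∷ [])
      (545392703 ∷ [])
  ∷ []) ∷
  ( node (1 ∷ 2 ∷ 4 ∷ 7 ∷ 8 ∷ 11 ∷ 13 ∷ 14 ∷ 16 ∷ 19 ∷ 21 ∷ 22 ∷ 25 ∷ 26 ∷ 28 ∷ 31 ∷ []) []
  ∷ []) ∷
  -- The 16-point cap just listed consists of the points with an odd number of coordinates 1, the
  -- complement of a hyperplane. It is complete, which leaves level 17 empty.
  [] ∷
  []

set-root : List Move
set-root = moves
  (545392673 ∷ 545391682 ∷ 545391715 ∷ 545326212 ∷ 545326245 ∷ 545326278 ∷ 545326311 ∷ 541132040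
   ∷ 541132073 ∷ 541132106 ∷ 541132139 ∷ 541132172 ∷ 541132205 ∷ 541132238 ∷ 541132271 ∷ 272696848
   ∷ 272696881 ∷ 272696914 ∷ 272696947 ∷ 272696980 ∷ 272697013 ∷ 272697046 ∷ 272697079 ∷ 272697112
   ∷ 272697145 ∷ 272697178 ∷ 272697211 ∷ 272697244 ∷ 272697277 ∷ 272697310 ∷ 272697343 ∷ [])

set-levels : List (List Node)
set-levels =
  ( node (1 ∷ [])
      (545392674 ∷ 545393699 ∷ 545329188 ∷ 545330213 ∷ 545331238 ∷ 545332263 ∷ 541138984 ∷ 541140009
       ∷ 541141034 ∷ 541142059 ∷ 541143084 ∷ 541144109 ∷ 541145134 ∷ 541146159 ∷ 272711728
       ∷ 272712753 ∷ 272713778 ∷ 272714803 ∷ 272715828 ∷ 272716853 ∷ 272717878 ∷ 272718903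
       ∷ 272719928 ∷ 272720953 ∷ 272721978 ∷ 272723003 ∷ 272724028 ∷ 272725053 ∷ 272726078
       ∷ 272727103 ∷ [])
  ∷ []) ∷
  ( node (1 ∷ 2 ∷ [])
      (545392675 ∷ 1619134500 ∷ 1619167269 ∷ 1619200038 ∷ 1619232807 ∷ 1615071272 ∷ 1615104041
       ∷ 1615136810 ∷ 1615169579 ∷ 1615202348 ∷ 1615235117 ∷ 1615267886 ∷ 1615300655 ∷ 1346897968
       ∷ 1346930737 ∷ 1346963506 ∷ 1346996275 ∷ 1347029044 ∷ 1347061813 ∷ 1347094582 ∷ 1347127351
       ∷ 1347160120 ∷ 1347192889 ∷ 1347225658 ∷ 1347258427 ∷ 1347291196 ∷ 1347323965 ∷ 1347356734
       ∷ 1347389503 ∷ [])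
  ∷ []) ∷
  ( node (1 ∷ 2 ∷ 3 ∷ [])
      (545392676 ∷ 545425445 ∷ 545458214 ∷ 545490983 ∷ 541329448 ∷ 541362217 ∷ 541394986 ∷ 541427755
       ∷ 541460524 ∷ 541493293 ∷ 541526062 ∷ 541558831 ∷ 273156144 ∷ 273188913 ∷ 273221682
       ∷ 273254451 ∷ 273287220 ∷ 273319989 ∷ 273352758 ∷ 273385527 ∷ 273418296 ∷ 273451065
       ∷ 273483834 ∷ 273516603 ∷ 273549372 ∷ 273582141 ∷ 273614910 ∷ 273647679 ∷ [])
  ∷ node (1 ∷ 2 ∷ 4 ∷ [])
      (545392675 ∷ 545329189 ∷ 545296454 ∷ 1619134503 ∷ 2692876328 ∷ 2693924905 ∷ 2694973482
       ∷ 2696022059 ∷ 2697070636 ∷ 2698119213 ∷ 2699167790 ∷ 2700216367 ∷ 2432829488 ∷ 2433878065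
       ∷ 2434926642 ∷ 2435975219 ∷ 2437023796 ∷ 2438072373 ∷ 2439120950 ∷ 2440169527 ∷ 2441218104
       ∷ 2442266681 ∷ 2443315258 ∷ 2444363835 ∷ 2445412412 ∷ 2446460989 ∷ 2447509566 ∷ 2448558143
       ∷ [])
  ∷ []) ∷
  ( node (1 ∷ 2 ∷ 3 ∷ 4 ∷ [])
      (545392677 ∷ 545391686 ∷ 545391719 ∷ 1619134504 ∷ 1620183081 ∷ 1621231658 ∷ 1622280235
       ∷ 1623328812 ∷ 1624377389 ∷ 1625425966 ∷ 1626474543 ∷ 1359087664 ∷ 1360136241 ∷ 1361184818
       ∷ 1362233395 ∷ 1363281972 ∷ 1364330549 ∷ 1365379126 ∷ 1366427703 ∷ 1367476280 ∷ 1368524857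
       ∷ 1369573434 ∷ 1370622011 ∷ 1371670588 ∷ 1372719165 ∷ 1373767742 ∷ 1374816319 ∷ [])
  ∷ node (1 ∷ 2 ∷ 4 ∷ 7 ∷ [])
      (545391715 ∷ 545326245 ∷ 545326278 ∷ 2692876328 ∷ 2693924905 ∷ 2694973482 ∷ 2696022059
       ∷ 2697070636 ∷ 2698119213 ∷ 2699167790 ∷ 2700216367 ∷ 2432829488 ∷ 2433878065 ∷ 2434926642
       ∷ 2435975219 ∷ 2437023796 ∷ 2438072373 ∷ 2439120950 ∷ 2440169527 ∷ 2441218104 ∷ 2442266681
       ∷ 2443315258 ∷ 2444363835 ∷ 2445412412 ∷ 2446460989 ∷ 2447509566 ∷ 2448558143 ∷ [])
  ∷ node (1 ∷ 2 ∷ 4 ∷ 8 ∷ [])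
      (1619134499 ∷ 1619071013 ∷ 1619038278 ∷ 2692876327 ∷ 1614880809 ∷ 1614848074 ∷ 2688813099
       ∷ 1612750988 ∷ 2686717997 ∷ 2685669454 ∷ 3766618159 ∷ 4840359984 ∷ 4873914417 ∷ 4907468850
       ∷ 4941023283 ∷ 4974577716 ∷ 5008132149 ∷ 5041686582 ∷ 5075241015 ∷ 5108795448 ∷ 5142349881
       ∷ 5175904314 ∷ 5209458747 ∷ 5243013180 ∷ 5276567613 ∷ 5310122046 ∷ 5343676479 ∷ [])
  ∷ []) ∷
  ( node (1 ∷ 2 ∷ 3 ∷ 4 ∷ 5 ∷ [])
      (545392678 ∷ 545425447 ∷ 1619134504 ∷ 1620183081 ∷ 1621231658 ∷ 1622280235 ∷ 1623328812
       ∷ 1624377389 ∷ 1625425966 ∷ 1626474543 ∷ 1359087664 ∷ 1360136241 ∷ 1361184818 ∷ 1362233395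
       ∷ 1363281972 ∷ 1364330549 ∷ 1365379126 ∷ 1366427703 ∷ 1367476280 ∷ 1368524857 ∷ 1369573434
       ∷ 1370622011 ∷ 1371670588 ∷ 1372719165 ∷ 1373767742 ∷ 1374816319 ∷ [])
  ∷ node (1 ∷ 2 ∷ 3 ∷ 4 ∷ 8 ∷ [])
      (1619134501 ∷ 1619133510 ∷ 1619133543 ∷ 1615071273 ∷ 1615070282 ∷ 1615070315 ∷ 2692876332
       ∷ 3766618157 ∷ 3766617166 ∷ 3766617199 ∷ 4840359984 ∷ 4873914417 ∷ 4907468850 ∷ 4941023283
       ∷ 4974577716 ∷ 5008132149 ∷ 5041686582 ∷ 5075241015 ∷ 5108795448 ∷ 5142349881 ∷ 5175904314
       ∷ 5209458747 ∷ 5243013180 ∷ 5276567613 ∷ 5310122046 ∷ 5343676479 ∷ [])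
  ∷ node (1 ∷ 2 ∷ 4 ∷ 7 ∷ 8 ∷ [])
      (1619133539 ∷ 1619068069 ∷ 1619068102 ∷ 3762364457 ∷ 3762331722 ∷ 5914101803 ∷ 3760234636
       ∷ 5914038317 ∷ 5914041390 ∷ 3760234735 ∷ 6987843632 ∷ 7021398065 ∷ 7054952498 ∷ 7088506931
       ∷ 7122061364 ∷ 7155615797 ∷ 7189170230 ∷ 7222724663 ∷ 7256279096 ∷ 7289833529 ∷ 7323387962
       ∷ 7356942395 ∷ 7390496828 ∷ 7424051261 ∷ 7457605694 ∷ 7491160127 ∷ [])
  ∷ node (1 ∷ 2 ∷ 4 ∷ 8 ∷ 15 ∷ [])
      (3766617187 ∷ 3766551717 ∷ 3766520006 ∷ 3760234727 ∷ 3762357545 ∷ 3762325834 ∷ 3760230763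
       ∷ 3760230796 ∷ 3762325933 ∷ 3762357710 ∷ 8061585456 ∷ 8095139889 ∷ 8128694322 ∷ 8162248755
       ∷ 8195803188 ∷ 8229357621 ∷ 8262912054 ∷ 8296466487 ∷ 8330020920 ∷ 8363575353 ∷ 8397129786
       ∷ 8430684219 ∷ 8464238652 ∷ 8497793085 ∷ 8531347518 ∷ 8564901951 ∷ [])
  ∷ node (1 ∷ 2 ∷ 4 ∷ 8 ∷ 16 ∷ [])
      (4840359971 ∷ 4840296485 ∷ 4840263750 ∷ 6987843623 ∷ 4836106281 ∷ 4836073546 ∷ 6983780395
       ∷ 4833976460 ∷ 6981685293 ∷ 6980636750 ∷ 8061585455 ∷ 4567679025 ∷ 4567646290 ∷ 6715607091
       ∷ 4565549204 ∷ 6713511989 ∷ 6712463446 ∷ 7801538615 ∷ 4431331608 ∷ 6579298361 ∷ 6578249818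
       ∷ 7667451963 ∷ 6511141020 ∷ 7600345149 ∷ 7566790750 ∷ 9135327295 ∷ [])
  ∷ []) ∷
  ( node (1 ∷ 2 ∷ 3 ∷ 4 ∷ 5 ∷ 6 ∷ [])
      (545392679 ∷ 1619134504 ∷ 1620183081 ∷ 1621231658 ∷ 1622280235 ∷ 1623328812 ∷ 1624377389
       ∷ 1625425966 ∷ 1626474543 ∷ 1359087664 ∷ 1360136241 ∷ 1361184818 ∷ 1362233395 ∷ 1363281972
       ∷ 1364330549 ∷ 1365379126 ∷ 1366427703 ∷ 1367476280 ∷ 1368524857 ∷ 1369573434 ∷ 1370622011
       ∷ 1371670588 ∷ 1372719165 ∷ 1373767742 ∷ 1374816319 ∷ [])
  ∷ node (1 ∷ 2 ∷ 3 ∷ 4 ∷ 5 ∷ 8 ∷ [])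
      (1619134502 ∷ 1619167271 ∷ 2692876329 ∷ 3766618154 ∷ 3766619179 ∷ 3766554668 ∷ 3766555693
       ∷ 4840359982 ∷ 4840392751 ∷ 5914101808 ∷ 5947656241 ∷ 5981210674 ∷ 6014765107 ∷ 6048319540
       ∷ 6081873973 ∷ 6115428406 ∷ 6148982839 ∷ 6182537272 ∷ 6216091705 ∷ 6249646138 ∷ 6283200571
       ∷ 6316755004 ∷ 6350309437 ∷ 6383863870 ∷ 6417418303 ∷ [])
  ∷ node (1 ∷ 2 ∷ 3 ∷ 4 ∷ 8 ∷ 12 ∷ [])
      (3766554661 ∷ 3766521926 ∷ 3766521959 ∷ 3762364457 ∷ 3762331722 ∷ 3762331755 ∷ 3762368557
       ∷ 3762335822 ∷ 3762335855 ∷ 6987843632 ∷ 7021398065 ∷ 7054952498 ∷ 7088506931 ∷ 7122061364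
       ∷ 7155615797 ∷ 7189170230 ∷ 7222724663 ∷ 7256279096 ∷ 7289833529 ∷ 7323387962 ∷ 7356942395
       ∷ 7390496828 ∷ 7424051261 ∷ 7457605694 ∷ 7491160127 ∷ [])
  ∷ node (1 ∷ 2 ∷ 3 ∷ 4 ∷ 8 ∷ 13 ∷ [])
      (3766555685 ∷ 4840358982 ∷ 4840359015 ∷ 3762365481 ∷ 4836295754 ∷ 4836295787 ∷ 3762368556
       ∷ 4836459630 ∷ 4836459599 ∷ 8061585456 ∷ 8095139889 ∷ 8128694322 ∷ 8162248755 ∷ 8195803188
       ∷ 8229357621 ∷ 8262912054 ∷ 8296466487 ∷ 8330020920 ∷ 8363575353 ∷ 8397129786 ∷ 8430684219
       ∷ 8464238652 ∷ 8497793085 ∷ 8531347518 ∷ 8564901951 ∷ [])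
  ∷ node (1 ∷ 2 ∷ 3 ∷ 4 ∷ 8 ∷ 16 ∷ [])
      (5914101797 ∷ 5914100806 ∷ 5914100839 ∷ 5910038569 ∷ 5910037578 ∷ 5910037611 ∷ 6987843628
       ∷ 8061585453 ∷ 8061584462 ∷ 8061584495 ∷ 5641865265 ∷ 5641864274 ∷ 5641864307 ∷ 6727796788
       ∷ 7801538613 ∷ 7801537622 ∷ 7801537655 ∷ 6593710136 ∷ 7667451961 ∷ 7667450970 ∷ 7667451003
       ∷ 9135327292 ∷ 10209069117 ∷ 10209068126 ∷ 10209068159 ∷ [])
  ∷ node (1 ∷ 2 ∷ 4 ∷ 7 ∷ 8 ∷ 11 ∷ [])
      (2692875363 ∷ 4840293541 ∷ 4840293574 ∷ 4836099369 ∷ 4836099402 ∷ 4833120652 ∷ 11282810925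
       ∷ 11285956654 ∷ 4833120751 ∷ 12356552752 ∷ 12390107185 ∷ 12423661618 ∷ 12457216051
       ∷ 12490770484 ∷ 12524324917 ∷ 12557879350 ∷ 12591433783 ∷ 12624988216 ∷ 12658542649
       ∷ 12692097082 ∷ 12725651515 ∷ 12759205948 ∷ 12792760381 ∷ 12826314814 ∷ 12859869247 ∷ [])
  ∷ node (1 ∷ 2 ∷ 4 ∷ 7 ∷ 8 ∷ 16 ∷ [])
      (5914100835 ∷ 5914035365 ∷ 5914035398 ∷ 8057331753 ∷ 8057299018 ∷ 12356552747 ∷ 8055201932
       ∷ 12356489261 ∷ 12356492334 ∷ 8055202031 ∷ 7788904497 ∷ 7788871762 ∷ 12096505907 ∷ 7786774676
       ∷ 12096442421 ∷ 12096445494 ∷ 7786774775 ∷ 8726298904 ∷ 13430294585 ∷ 13430293594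
       ∷ 14504036411 ∷ 13430228124 ∷ 14503972925 ∷ 14503975998 ∷ 13430228223 ∷ [])
  ∷ node (1 ∷ 2 ∷ 4 ∷ 8 ∷ 15 ∷ 16 ∷ [])
      (8061584483 ∷ 8061519013 ∷ 8061487302 ∷ 8055202023 ∷ 8057324841 ∷ 8057293130 ∷ 8055198059
       ∷ 8055198092 ∷ 8057293229 ∷ 8057325006 ∷ 9936388145 ∷ 9936355410 ∷ 14231799859 ∷ 9934258324
       ∷ 14229704757 ∷ 14228656214 ∷ 14027341079 ∷ 9800040728 ∷ 14095491129 ∷ 14094442586
       ∷ 14027340955 ∷ 14027333788 ∷ 14094449757 ∷ 14095498302 ∷ 9800040959 ∷ [])
  ∷ node (1 ∷ 2 ∷ 4 ∷ 8 ∷ 16 ∷ 31 ∷ [])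
      (10209068131 ∷ 10209002661 ∷ 10208970950 ∷ 13430228199 ∷ 10204808489 ∷ 10204776778
       ∷ 13426034027 ∷ 10202681740 ∷ 13424002477 ∷ 13021742542 ∷ 9800040943 ∷ 9936373297
       ∷ 9936341586 ∷ 13157598835 ∷ 9934246548 ∷ 13155567285 ∷ 13021480662 ∷ 9800033015 ∷ 9800033048
       ∷ 13021480761 ∷ 13155567450 ∷ 9934246779 ∷ 13157599132 ∷ 9936341949 ∷ 9936373726 ∷ [])
  ∷ []) ∷
  ( node (1 ∷ 2 ∷ 3 ∷ 4 ∷ 5 ∷ 6 ∷ 7 ∷ [])
      (545392680 ∷ 546441257 ∷ 547489834 ∷ 548538411 ∷ 549586988 ∷ 550635565 ∷ 551684142 ∷ 552732719
       ∷ 285345840 ∷ 286394417 ∷ 287442994 ∷ 288491571 ∷ 289540148 ∷ 290588725 ∷ 291637302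
       ∷ 292685879 ∷ 293734456 ∷ 294783033 ∷ 295831610 ∷ 296880187 ∷ 297928764 ∷ 298977341
       ∷ 300025918 ∷ 301074495 ∷ [])
  ∷ node (1 ∷ 2 ∷ 3 ∷ 4 ∷ 5 ∷ 6 ∷ 8 ∷ [])
      (545392679 ∷ 1619134505 ∷ 1619133514 ∷ 1619166315 ∷ 1619068044 ∷ 1619100845 ∷ 1619101902
       ∷ 2692876335 ∷ 3766618160 ∷ 3800172593 ∷ 3833727026 ∷ 3867281459 ∷ 3900835892 ∷ 3934390325
       ∷ 3967944758 ∷ 4001499191 ∷ 4035053624 ∷ 4068608057 ∷ 4102162490 ∷ 4135716923 ∷ 4169271356
       ∷ 4202825789 ∷ 4236380222 ∷ 4269934655 ∷ [])
  ∷ node (1 ∷ 2 ∷ 3 ∷ 4 ∷ 5 ∷ 8 ∷ 9 ∷ [])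
      (1619134502 ∷ 1619167271 ∷ 1615071274 ∷ 1615104043 ∷ 1612976172 ∷ 1613008941 ∷ 4840359982
       ∷ 4841408559 ∷ 5914101808 ∷ 5947656241 ∷ 5981210674 ∷ 6014765107 ∷ 6048319540 ∷ 6081873973
       ∷ 6115428406 ∷ 6148982839 ∷ 6182537272 ∷ 6216091705 ∷ 6249646138 ∷ 6283200571 ∷ 6316755004
       ∷ 6350309437 ∷ 6383863870 ∷ 6417418303 ∷ [])
  ∷ node (1 ∷ 2 ∷ 3 ∷ 4 ∷ 5 ∷ 8 ∷ 10 ∷ [])
      (1619133510 ∷ 1619166279 ∷ 1615071273 ∷ 1615136811 ∷ 6987843628 ∷ 6987876397 ∷ 6989940782
       ∷ 6989973551 ∷ 8061585456 ∷ 8095139889 ∷ 8128694322 ∷ 8162248755 ∷ 8195803188 ∷ 8229357621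
       ∷ 8262912054 ∷ 8296466487 ∷ 8330020920 ∷ 8363575353 ∷ 8397129786 ∷ 8430684219 ∷ 8464238652
       ∷ 8497793085 ∷ 8531347518 ∷ 8564901951 ∷ [])
  ∷ node (1 ∷ 2 ∷ 3 ∷ 4 ∷ 5 ∷ 8 ∷ 14 ∷ [])
      (1619101894 ∷ 2692909095 ∷ 4840359977 ∷ 6989940778 ∷ 6991023147 ∷ 6992037932 ∷ 6993120301
       ∷ 4846651439 ∷ 9135327280 ∷ 9168881713 ∷ 9202436146 ∷ 9235990579 ∷ 9269545012 ∷ 9303099445
       ∷ 9336653878 ∷ 9370208311 ∷ 9403762744 ∷ 9437317177 ∷ 9470871610 ∷ 9504426043 ∷ 9537980476
       ∷ 9571534909 ∷ 9605089342 ∷ 9638643775 ∷ [])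
  ∷ node (1 ∷ 2 ∷ 3 ∷ 4 ∷ 5 ∷ 8 ∷ 16 ∷ [])
      (3766618150 ∷ 3766650919 ∷ 5914101801 ∷ 8061585450 ∷ 8061586475 ∷ 8061521964 ∷ 8061522989
       ∷ 9135327278 ∷ 9135360047 ∷ 5654054961 ∷ 7801538610 ∷ 7801539635 ∷ 7801475124 ∷ 7801476149
       ∷ 8875280438 ∷ 8875313207 ∷ 10209069112 ∷ 11282810937 ∷ 12356552762 ∷ 12356553787
       ∷ 12356489276 ∷ 12356490301 ∷ 13430294590 ∷ 13430327359 ∷ [])
  ∷ node (1 ∷ 2 ∷ 3 ∷ 4 ∷ 8 ∷ 12 ∷ 16 ∷ [])
      (8061521957 ∷ 8061489222 ∷ 8061489255 ∷ 8057331753 ∷ 8057299018 ∷ 8057299051 ∷ 8057335853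
       ∷ 8057303118 ∷ 8057303151 ∷ 9936832561 ∷ 9936831570 ∷ 9936831603 ∷ 9732366484 ∷ 14504036405
       ∷ 14504035414 ∷ 14504035447 ∷ 9732362520 ∷ 14499973177 ∷ 14499972186 ∷ 14499972219
       ∷ 9732362652 ∷ 14500104253 ∷ 14500103262 ∷ 14500103295 ∷ [])
  ∷ node (1 ∷ 2 ∷ 3 ∷ 4 ∷ 8 ∷ 13 ∷ 16 ∷ [])
      (8061522981 ∷ 9135326278 ∷ 9135326311 ∷ 8057332777 ∷ 9131263050 ∷ 9131263083 ∷ 8057335852
       ∷ 9131426926 ∷ 9131426895 ∷ 11010574385 ∷ 12084315218 ∷ 12084315251 ∷ 14243989556
       ∷ 15577778229 ∷ 16651520054 ∷ 16651521079 ∷ 14109902904 ∷ 15573715001 ∷ 16647456826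
       ∷ 16647457851 ∷ 15573878844 ∷ 14110066749 ∷ 16647621694 ∷ 16647620671 ∷ [])
  ∷ node (1 ∷ 2 ∷ 3 ∷ 4 ∷ 8 ∷ 16 ∷ 28 ∷ [])
      (12356489253 ∷ 12356456518 ∷ 12356456551 ∷ 12352299049 ∷ 12352266314 ∷ 12352266347
       ∷ 9732362636 ∷ 15573878829 ∷ 15573910606 ∷ 15573943407 ∷ 12083871793 ∷ 12083839058
       ∷ 12083839091 ∷ 9732100756 ∷ 15305705525 ∷ 15305737302 ∷ 15305770103 ∷ 9732100888
       ∷ 15305836601 ∷ 15305868378 ∷ 15305901179 ∷ 12083884093 ∷ 12083851358 ∷ 12083851391 ∷ [])
  ∷ node (1 ∷ 2 ∷ 3 ∷ 4 ∷ 8 ∷ 16 ∷ 29 ∷ [])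
      (12356490277 ∷ 13430293574 ∷ 13430293607 ∷ 12352300073 ∷ 13426230346 ∷ 13426230379
       ∷ 14500104236 ∷ 14110066733 ∷ 16647654478 ∷ 16257616975 ∷ 12083872817 ∷ 13158057042
       ∷ 13158057075 ∷ 14231930932 ∷ 14101940277 ∷ 16379481174 ∷ 16249490519 ∷ 14102038584
       ∷ 14232094777 ∷ 16249588826 ∷ 16379645019 ∷ 12083884092 ∷ 13158483070 ∷ 13158483039 ∷ [])
  ∷ node (1 ∷ 2 ∷ 4 ∷ 7 ∷ 8 ∷ 11 ∷ 13 ∷ [])
      (4840359011 ∷ 4840293541 ∷ 4843439302 ∷ 4836099369 ∷ 4839245130 ∷ 4839310732 ∷ 17725261870
       ∷ 4839311855 ∷ 18799003696 ∷ 18832558129 ∷ 18866112562 ∷ 18899666995 ∷ 18933221428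
       ∷ 18966775861 ∷ 19000330294 ∷ 19033884727 ∷ 19067439160 ∷ 19100993593 ∷ 19134548026
       ∷ 19168102459 ∷ 19201656892 ∷ 19235211325 ∷ 19268765758 ∷ 19302320191 ∷ [])
  ∷ node (1 ∷ 2 ∷ 4 ∷ 7 ∷ 8 ∷ 11 ∷ 16 ∷ [])
      (5914100835 ∷ 9135260837 ∷ 9135260870 ∷ 9131066665 ∷ 9131066698 ∷ 9128087948 ∷ 18799003693
       ∷ 18802149422 ∷ 9128088047 ∷ 15305097265 ∷ 15305064530 ∷ 19872745523 ∷ 15302115476
       ∷ 20946487349 ∷ 20946585654 ∷ 15302017271 ∷ 15168028952 ∷ 20942424121 ∷ 20942522426
       ∷ 15167930747 ∷ 20939283612 ∷ 22020229181 ∷ 22023374910 ∷ 20939381919 ∷ [])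
  ∷ node (1 ∷ 2 ∷ 4 ∷ 7 ∷ 8 ∷ 16 ∷ 25 ∷ [])
      (12356551779 ∷ 12356486309 ∷ 12356486342 ∷ 11948000553 ∷ 16647233610 ∷ 20942424107
       ∷ 16645136524 ∷ 20940329005 ∷ 20940332078 ∷ 16645136623 ∷ 11947738673 ∷ 16378806354
       ∷ 20674250803 ∷ 16376709268 ∷ 20672155701 ∷ 20672158774 ∷ 16376709367 ∷ 11947738904
       ∷ 20674545722 ∷ 16378815579 ∷ 20672450620 ∷ 16376718493 ∷ 16376718590 ∷ 20672453695 ∷ [])
  ∷ node (1 ∷ 2 ∷ 4 ∷ 7 ∷ 8 ∷ 16 ∷ 27 ∷ [])
      (11282809955 ∷ 13430228133 ∷ 13430228166 ∷ 16647267369 ∷ 16647235658 ∷ 15167930731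
       ∷ 16644288652 ∷ 22020165677 ∷ 22020168750 ∷ 16644193519 ∷ 16378840113 ∷ 16378808402
       ∷ 15168184947 ∷ 16375861396 ∷ 21760118837 ∷ 21760121910 ∷ 16375766263 ∷ 15168545560
       ∷ 16378815577 ∷ 16378849338 ∷ 16375771388 ∷ 21771656253 ∷ 21771653182 ∷ 16375872671 ∷ [])
  ∷ []) ∷
  ( node (1 ∷ 2 ∷ 3 ∷ 4 ∷ 5 ∷ 6 ∷ 7 ∷ 8 ∷ [])
      (545392681 ∷ 545391690 ∷ 545391723 ∷ 545326220 ∷ 545326253 ∷ 545326286 ∷ 545326319
       ∷ 1619134512 ∷ 1652688945 ∷ 1686243378 ∷ 1719797811 ∷ 1753352244 ∷ 1786906677 ∷ 1820461110
       ∷ 1854015543 ∷ 1887569976 ∷ 1921124409 ∷ 1954678842 ∷ 1988233275 ∷ 2021787708 ∷ 2055342141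
       ∷ 2088896574 ∷ 2122451007 ∷ [])
  ∷ node (1 ∷ 2 ∷ 3 ∷ 4 ∷ 5 ∷ 6 ∷ 8 ∷ 9 ∷ [])
      (545392679 ∷ 2692876330 ∷ 2693924907 ∷ 2692812844 ∷ 2693861421 ∷ 3766618158 ∷ 3767666735
       ∷ 4840359984 ∷ 4873914417 ∷ 4907468850 ∷ 4941023283 ∷ 4974577716 ∷ 5008132149 ∷ 5041686582
       ∷ 5075241015 ∷ 5108795448 ∷ 5142349881 ∷ 5175904314 ∷ 5209458747 ∷ 5243013180 ∷ 5276567613
       ∷ 5310122046 ∷ 5343676479 ∷ [])
  ∷ node (1 ∷ 2 ∷ 3 ∷ 4 ∷ 5 ∷ 6 ∷ 8 ∷ 15 ∷ [])
      (545326311 ∷ 3767666729 ∷ 3768714314 ∷ 3769795691 ∷ 3770844268 ∷ 3771860045 ∷ 3772909614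
       ∷ 5914101808 ∷ 5947656241 ∷ 5981210674 ∷ 6014765107 ∷ 6048319540 ∷ 6081873973 ∷ 6115428406
       ∷ 6148982839 ∷ 6182537272 ∷ 6216091705 ∷ 6249646138 ∷ 6283200571 ∷ 6316755004 ∷ 6350309437
       ∷ 6383863870 ∷ 6417418303 ∷ [])
  ∷ node (1 ∷ 2 ∷ 3 ∷ 4 ∷ 5 ∷ 6 ∷ 8 ∷ 16 ∷ [])
      (1619134503 ∷ 4840359977 ∷ 4840358986 ∷ 4840391787 ∷ 4840293516 ∷ 4840326317 ∷ 4840327374
       ∷ 5914101807 ∷ 4580313137 ∷ 4580312146 ∷ 4580344947 ∷ 4580246676 ∷ 4580279477 ∷ 4580280534
       ∷ 5654054967 ∷ 6987843640 ∷ 8061585465 ∷ 8061584474 ∷ 8061617275 ∷ 8061519004 ∷ 8061551805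
       ∷ 8061552862 ∷ 9135327295 ∷ [])
  ∷ node (1 ∷ 2 ∷ 3 ∷ 4 ∷ 5 ∷ 8 ∷ 9 ∷ 14 ∷ [])
      (3766618150 ∷ 3767699495 ∷ 3762554922 ∷ 3763636267 ∷ 3760459820 ∷ 3761541165 ∷ 10209069103
       ∷ 11282810928 ∷ 11316365361 ∷ 11349919794 ∷ 11383474227 ∷ 11417028660 ∷ 11450583093
       ∷ 11484137526 ∷ 11517691959 ∷ 11551246392 ∷ 11584800825 ∷ 11618355258 ∷ 11651909691
       ∷ 11685464124 ∷ 11719018557 ∷ 11752572990 ∷ 11786127423 ∷ [])
  ∷ node (1 ∷ 2 ∷ 3 ∷ 4 ∷ 5 ∷ 8 ∷ 9 ∷ 16 ∷ [])
      (4840359974 ∷ 4840392743 ∷ 4836296746 ∷ 4836329515 ∷ 4834201644 ∷ 4834234413 ∷ 11282810926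
       ∷ 11283859503 ∷ 12356552753 ∷ 13430294578 ∷ 13430295603 ∷ 13430231092 ∷ 13430232117
       ∷ 14504036406 ∷ 14504069175 ∷ 13426040888 ∷ 13426041913 ∷ 14499973178 ∷ 14500005947
       ∷ 14497878076 ∷ 14497910845 ∷ 15577778238 ∷ 15578826815 ∷ [])
  ∷ node (1 ∷ 2 ∷ 3 ∷ 4 ∷ 5 ∷ 8 ∷ 10 ∷ 12 ∷ [])
      (2692780102 ∷ 3766649927 ∷ 2688622633 ∷ 3762620459 ∷ 3760590893 ∷ 3759546446 ∷ 16651520047
       ∷ 17725261872 ∷ 17758816305 ∷ 17792370738 ∷ 17825925171 ∷ 17859479604 ∷ 17893034037
       ∷ 17926588470 ∷ 17960142903 ∷ 17993697336 ∷ 18027251769 ∷ 18060806202 ∷ 18094360635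
       ∷ 18127915068 ∷ 18161469501 ∷ 18195023934 ∷ 18228578367 ∷ [])
  ∷ node (1 ∷ 2 ∷ 3 ∷ 4 ∷ 5 ∷ 8 ∷ 10 ∷ 16 ∷ [])
      (4840358982 ∷ 4840391751 ∷ 4836296745 ∷ 4836362283 ∷ 17725261868 ∷ 17725294637 ∷ 17727359022
       ∷ 17727391791 ∷ 13170247729 ∷ 13036160082 ∷ 18799003699 ∷ 19872745524 ∷ 19872778293
       ∷ 20946487350 ∷ 20946520119 ∷ 19868681304 ∷ 20942423129 ∷ 19868746842 ∷ 20942488667
       ∷ 22020229180 ∷ 22020261949 ∷ 22022326334 ∷ 22022359103 ∷ [])
  ∷ node (1 ∷ 2 ∷ 3 ∷ 4 ∷ 5 ∷ 8 ∷ 14 ∷ 16 ∷ [])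
      (4840327366 ∷ 5914134567 ∷ 11282810921 ∷ 17727359018 ∷ 17728441387 ∷ 17729456172 ∷ 17730538541
       ∷ 11289102383 ∷ 14243989553 ∷ 20686440498 ∷ 20686474291 ∷ 20686377012 ∷ 20686410805
       ∷ 23093970998 ∷ 24167712823 ∷ 25241454648 ∷ 26315196473 ∷ 27388938298 ∷ 27388972091
       ∷ 27395229756 ∷ 27395263549 ∷ 25247746110 ∷ 26321487935 ∷ [])
  ∷ node (1 ∷ 2 ∷ 3 ∷ 4 ∷ 5 ∷ 8 ∷ 16 ∷ 24 ∷ [])
      (6987843622 ∷ 6987876391 ∷ 13426040873 ∷ 19868681290 ∷ 19868681323 ∷ 19866584204 ∷ 19866584237
       ∷ 25241454638 ∷ 25241487407 ∷ 13157613617 ∷ 19600507986 ∷ 19600508019 ∷ 19598410900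
       ∷ 19598410933 ∷ 24981407798 ∷ 24981440567 ∷ 13157621817 ∷ 19600770138 ∷ 19600770171
       ∷ 19598673052 ∷ 19598673085 ∷ 24989796414 ∷ 24989829183 ∷ [])
  ∷ node (1 ∷ 2 ∷ 3 ∷ 4 ∷ 5 ∷ 8 ∷ 16 ∷ 25 ∷ [])
      (8061585446 ∷ 8061618215 ∷ 13426041897 ∷ 20942423114 ∷ 20942423147 ∷ 20940326028 ∷ 20940326061
       ∷ 26315196462 ∷ 26315229231 ∷ 13157614641 ∷ 20674249810 ∷ 20674249843 ∷ 20672152724
       ∷ 20672152757 ∷ 26055149622 ∷ 26055182391 ∷ 13157621816 ∷ 20674544762 ∷ 20674544731
       ∷ 20672447676 ∷ 20672447645 ∷ 26064619582 ∷ 26064586815 ∷ [])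
  ∷ node (1 ∷ 2 ∷ 3 ∷ 4 ∷ 5 ∷ 8 ∷ 16 ∷ 26 ∷ [])
      (8061584454 ∷ 8061617223 ∷ 14499973161 ∷ 19868746826 ∷ 20942521451 ∷ 22020165676 ∷ 22020166701
       ∷ 27388938286 ∷ 27388971055 ∷ 14231799857 ∷ 19600573522 ∷ 20674348147 ∷ 21760118836
       ∷ 21760119861 ∷ 27128891446 ∷ 27128924215 ∷ 19600770136 ∷ 20674544761 ∷ 14232127547
       ∷ 27139377212 ∷ 27139409981 ∷ 21770604606 ∷ 21770605631 ∷ [])
  ∷ node (1 ∷ 2 ∷ 3 ∷ 4 ∷ 5 ∷ 8 ∷ 16 ∷ 30 ∷ [])
      (8061552838 ∷ 9135360039 ∷ 15577778217 ∷ 22022326314 ∷ 22023408683 ∷ 22024359980 ∷ 22025442349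
       ∷ 25247746094 ∷ 26322569263 ∷ 15317731377 ∷ 21762279474 ∷ 21763361843 ∷ 21764313140
       ∷ 21765395509 ∷ 24987699254 ∷ 26062522423 ∷ 24989796408 ∷ 26064619577 ∷ 21770604602
       ∷ 21771686971 ∷ 21772765244 ∷ 21773847613 ∷ 15332411455 ∷ [])
  ∷ node (1 ∷ 2 ∷ 3 ∷ 4 ∷ 8 ∷ 12 ∷ 16 ∷ 21 ∷ [])
      (18798940197 ∷ 20946391110 ∷ 20946391143 ∷ 20940195081 ∷ 22015942730 ∷ 22015942763
       ∷ 20940195213 ∷ 22015946830 ∷ 22015946863 ∷ 19598018097 ∷ 24969217106 ∷ 24969217139
       ∷ 19598018196 ∷ 24969380982 ∷ 24969380951 ∷ 24764748056 ∷ 24764912025 ∷ 28462680122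
       ∷ 28634646587 ∷ 24764748188 ∷ 24764911901 ∷ 28466874430 ∷ 28630452287 ∷ [])
  ∷ node (1 ∷ 2 ∷ 3 ∷ 4 ∷ 8 ∷ 13 ∷ 16 ∷ 21 ∷ [])
      (12969051301 ∷ 23093969990 ∷ 23093970023 ∷ 20940195113 ∷ 27384874058 ∷ 27384874091
       ∷ 20940195212 ∷ 27385037934 ∷ 27385037903 ∷ 20671759921 ∷ 27116700754 ∷ 27116700787
       ∷ 20671760020 ∷ 27116864630 ∷ 27116864599 ∷ 24764654360 ∷ 29536421945 ∷ 30610163770
       ∷ 30610164795 ∷ 29704194108 ∷ 24764654525 ∷ 30777936958 ∷ 30777935935 ∷ [])
  ∷ node (1 ∷ 2 ∷ 3 ∷ 4 ∷ 8 ∷ 13 ∷ 16 ∷ 22 ∷ [])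
      (20946457637 ∷ 20686411846 ∷ 24167711847 ∷ 22015976489 ∷ 26311132234 ∷ 27384973419
       ∷ 22015979564 ∷ 27385071726 ∷ 26311296079 ∷ 26042959921 ∷ 21747517522 ∷ 27116799091
       ∷ 21747519572 ∷ 27116864629 ∷ 26043156535 ∷ 28068546616 ∷ 30606100537 ∷ 30807590970
       ∷ 28075001915 ∷ 30606264380 ∷ 28068710461 ∷ 28074838078 ∷ 30807427135 ∷ [])
  ∷ node (1 ∷ 2 ∷ 4 ∷ 7 ∷ 8 ∷ 11 ∷ 13 ∷ 14 ∷ [])
      (10209068131 ∷ 10209002661 ∷ 10209002694 ∷ 10204808489 ∷ 10204808522 ∷ 10204808588
       ∷ 10204808687 ∷ 31683905584 ∷ 31717460017 ∷ 31751014450 ∷ 31784568883 ∷ 31818123316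
       ∷ 31851677749 ∷ 31885232182 ∷ 31918786615 ∷ 31952341048 ∷ 31985895481 ∷ 32019449914
       ∷ 32053004347 ∷ 32086558780 ∷ 32120113213 ∷ 32153667646 ∷ 32187222079 ∷ [])
  ∷ node (1 ∷ 2 ∷ 4 ∷ 7 ∷ 8 ∷ 11 ∷ 13 ∷ 16 ∷ [])
      (11282809955 ∷ 11282744485 ∷ 11285890246 ∷ 11278550313 ∷ 11281696074 ∷ 11281761676
       ∷ 31683905582 ∷ 11281762799 ∷ 29263740977 ∷ 29364371538 ∷ 32757647411 ∷ 29429383316
       ∷ 32757583925 ∷ 32760732726 ∷ 29429383415 ∷ 29429383448 ∷ 32753393721 ∷ 32756542522
       ∷ 29429383547 ∷ 32756610108 ∷ 29364371901 ∷ 33831389246 ∷ 32756610143 ∷ [])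
  ∷ node (1 ∷ 2 ∷ 4 ∷ 7 ∷ 8 ∷ 11 ∷ 16 ∷ 19 ∷ [])
      (12356551779 ∷ 23093904549 ∷ 23093904582 ∷ 23089710377 ∷ 23089710410 ∷ 23086731660
       ∷ 32757647405 ∷ 32760793134 ∷ 23086731759 ∷ 22821275185 ∷ 22821275218 ∷ 22818296468
       ∷ 32497600565 ∷ 32500746294 ∷ 22818296567 ∷ 22684214040 ∷ 32363513913 ∷ 32366659642
       ∷ 22684214139 ∷ 32262855836 ∷ 34905131069 ∷ 35005794366 ∷ 32266001567 ∷ [])
  ∷ node (1 ∷ 2 ∷ 4 ∷ 7 ∷ 8 ∷ 11 ∷ 16 ∷ 21 ∷ [])
      (14504035427 ∷ 14243923109 ∷ 24167646406 ∷ 27384677673 ∷ 27384677706 ∷ 27381698956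
       ∷ 32757583917 ∷ 32760729646 ∷ 27381699055 ∷ 27114210865 ∷ 27113261650 ∷ 32497600563
       ∷ 27114210964 ∷ 32502843446 ∷ 27113261815 ∷ 30200414488 ∷ 35978872889 ∷ 35982018618
       ∷ 30200316283 ∷ 36146645052 ∷ 30200419613 ∷ 30200321406 ∷ 36149790783 ∷ [])
  ∷ node (1 ∷ 2 ∷ 4 ∷ 7 ∷ 8 ∷ 11 ∷ 16 ∷ 29 ∷ [])
      (15577777251 ∷ 26315130021 ∷ 26318275782 ∷ 26310935849 ∷ 26314081610 ∷ 26307957132
       ∷ 29364371885 ∷ 33834534958 ∷ 26309005807 ∷ 30337483825 ∷ 30438115410 ∷ 34905131059
       ∷ 30334505108 ∷ 30200419605 ∷ 30300985718 ∷ 30435073271 ∷ 30200422680 ∷ 30334510233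
       ∷ 30435076346 ∷ 30300990843 ∷ 30337495100 ∷ 35341338686 ∷ 30438128735 ∷ [])
  ∷ []) ∷
  ( node (1 ∷ 2 ∷ 3 ∷ 4 ∷ 5 ∷ 6 ∷ 7 ∷ 8 ∷ 9 ∷ [])
      (545392682 ∷ 546441259 ∷ 545329196 ∷ 546377773 ∷ 545331246 ∷ 546379823 ∷ 1619134512
       ∷ 1652688945 ∷ 1686243378 ∷ 1719797811 ∷ 1753352244 ∷ 1786906677 ∷ 1820461110 ∷ 1854015543
       ∷ 1887569976 ∷ 1921124409 ∷ 1954678842 ∷ 1988233275 ∷ 2021787708 ∷ 2055342141 ∷ 2088896574
       ∷ 2122451007 ∷ [])
  ∷ node (1 ∷ 2 ∷ 3 ∷ 4 ∷ 5 ∷ 6 ∷ 7 ∷ 8 ∷ 16 ∷ [])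
      (1619134505 ∷ 1619133514 ∷ 1619133547 ∷ 1619068044 ∷ 1619068077 ∷ 1619068110 ∷ 1619068143
       ∷ 1359087665 ∷ 1359086674 ∷ 1359086707 ∷ 1359021204 ∷ 1359021237 ∷ 1359021270 ∷ 1359021303
       ∷ 2692876344 ∷ 3766618169 ∷ 3766617178 ∷ 3766617211 ∷ 3766551708 ∷ 3766551741 ∷ 3766551774
       ∷ 3766551807 ∷ [])
  ∷ node (1 ∷ 2 ∷ 3 ∷ 4 ∷ 5 ∷ 6 ∷ 8 ∷ 9 ∷ 10 ∷ [])
      (545392679 ∷ 541329451 ∷ 4840359980 ∷ 5914101805 ∷ 5914100814 ∷ 5915182191 ∷ 6987843632
       ∷ 7021398065 ∷ 7054952498 ∷ 7088506931 ∷ 7122061364 ∷ 7155615797 ∷ 7189170230 ∷ 7222724663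
       ∷ 7256279096 ∷ 7289833529 ∷ 7323387962 ∷ 7356942395 ∷ 7390496828 ∷ 7424051261 ∷ 7457605694
       ∷ 7491160127 ∷ [])
  ∷ node (1 ∷ 2 ∷ 3 ∷ 4 ∷ 5 ∷ 6 ∷ 8 ∷ 9 ∷ 14 ∷ [])
      (545331239 ∷ 5914100810 ∷ 5914133611 ∷ 5914035340 ∷ 5914068141 ∷ 8061585455 ∷ 9135327280
       ∷ 9168881713 ∷ 9202436146 ∷ 9235990579 ∷ 9269545012 ∷ 9303099445 ∷ 9336653878 ∷ 9370208311
       ∷ 9403762744 ∷ 9437317177 ∷ 9470871610 ∷ 9504426043 ∷ 9537980476 ∷ 9571534909 ∷ 9605089342
       ∷ 9638643775 ∷ [])
  ∷ node (1 ∷ 2 ∷ 3 ∷ 4 ∷ 5 ∷ 6 ∷ 8 ∷ 9 ∷ 16 ∷ [])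
      (1619134503 ∷ 6987843626 ∷ 6988892203 ∷ 6987780140 ∷ 6988828717 ∷ 9135327278 ∷ 9136375855
       ∷ 10209069105 ∷ 11282810930 ∷ 11282844723 ∷ 11282747444 ∷ 11282781237 ∷ 12356552758
       ∷ 13430294583 ∷ 14504036408 ∷ 14505084985 ∷ 15577778234 ∷ 15578826811 ∷ 15577714748
       ∷ 15578763325 ∷ 16651520062 ∷ 16652568639 ∷ [])
  ∷ node (1 ∷ 2 ∷ 3 ∷ 4 ∷ 5 ∷ 6 ∷ 8 ∷ 15 ∷ 16 ∷ [])
      (1619068135 ∷ 9136375849 ∷ 9137423434 ∷ 9138504811 ∷ 9139553388 ∷ 9140569165 ∷ 9141618734
       ∷ 13170247729 ∷ 13170246738 ∷ 13170279539 ∷ 13170181268 ∷ 13170214069 ∷ 13170215126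
       ∷ 17725261879 ∷ 18799003704 ∷ 19872745529 ∷ 19872744538 ∷ 19872777339 ∷ 19880117372
       ∷ 19880084573 ∷ 19880085566 ∷ 18806343743 ∷ [])
  ∷ node (1 ∷ 2 ∷ 3 ∷ 4 ∷ 5 ∷ 6 ∷ 8 ∷ 16 ∷ 24 ∷ [])
      (2692876327 ∷ 14504036393 ∷ 14504035402 ∷ 14504068203 ∷ 14503969932 ∷ 14504002733
       ∷ 14504003790 ∷ 18799003695 ∷ 14243989553 ∷ 14243988562 ∷ 14244021363 ∷ 14243923092
       ∷ 14243955893 ∷ 14243956950 ∷ 18538956855 ∷ 14252378169 ∷ 14252377178 ∷ 14252409979
       ∷ 14252311708 ∷ 14252344509 ∷ 14252345566 ∷ 18547345471 ∷ [])
  ∷ node (1 ∷ 2 ∷ 3 ∷ 4 ∷ 5 ∷ 6 ∷ 8 ∷ 16 ∷ 25 ∷ [])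
      (3766618151 ∷ 14505084969 ∷ 15577777226 ∷ 15577810027 ∷ 15577711756 ∷ 15577744557
       ∷ 16651487438 ∷ 19872745519 ∷ 14245038129 ∷ 15317730386 ∷ 15317763187 ∷ 15317664916
       ∷ 15317697717 ∷ 16391440598 ∷ 19612698679 ∷ 14252378168 ∷ 15327200378 ∷ 15327167579
       ∷ 15327134908 ∷ 15327102109 ∷ 19622135870 ∷ 16400877791 ∷ [])
  ∷ node (1 ∷ 2 ∷ 3 ∷ 4 ∷ 5 ∷ 6 ∷ 8 ∷ 16 ∷ 31 ∷ [])
      (3766551783 ∷ 16652568617 ∷ 16653616202 ∷ 16654697579 ∷ 16655647884 ∷ 16656729261
       ∷ 16657778894 ∷ 18806343727 ∷ 16392521777 ∷ 16393569362 ∷ 16394650739 ∷ 16395601044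
       ∷ 16396682421 ∷ 16397732054 ∷ 18546296887 ∷ 18547345464 ∷ 16400877785 ∷ 16401925306
       ∷ 16402941083 ∷ 16404087932 ∷ 16405103709 ∷ 16406153278 ∷ [])
  ∷ node (1 ∷ 2 ∷ 3 ∷ 4 ∷ 5 ∷ 8 ∷ 9 ∷ 14 ∷ 15 ∷ [])
      (8061585446 ∷ 8061618215 ∷ 8057522218 ∷ 8057554987 ∷ 8057718828 ∷ 8057751597 ∷ 20946487344
       ∷ 20980041777 ∷ 21013596210 ∷ 21047150643 ∷ 21080705076 ∷ 21114259509 ∷ 21147813942
       ∷ 21181368375 ∷ 21214922808 ∷ 21248477241 ∷ 21282031674 ∷ 21315586107 ∷ 21349140540
       ∷ 21382694973 ∷ 21416249406 ∷ 21449803839 ∷ [])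
  ∷ node (1 ∷ 2 ∷ 3 ∷ 4 ∷ 5 ∷ 8 ∷ 9 ∷ 14 ∷ 16 ∷ [])
      (9135327270 ∷ 9136408615 ∷ 9131264042 ∷ 9132345387 ∷ 9129168940 ∷ 9130250285 ∷ 20946487343
       ∷ 22020229169 ∷ 23093970994 ∷ 23095020595 ∷ 23093907508 ∷ 23094957109 ∷ 24167712822
       ∷ 24168794167 ∷ 23089717304 ∷ 23090766905 ∷ 24163649594 ∷ 24164730939 ∷ 24161554492
       ∷ 24162635837 ∷ 25241454654 ∷ 26315196479 ∷ [])
  ∷ node (1 ∷ 2 ∷ 3 ∷ 4 ∷ 5 ∷ 8 ∷ 9 ∷ 16 ∷ 17 ∷ [])
      (10209069094 ∷ 10209101863 ∷ 10205005866 ∷ 10205038635 ∷ 10202910764 ∷ 10202943533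
       ∷ 22020229166 ∷ 22021277743 ∷ 9936832562 ∷ 9936865331 ∷ 9934737460 ∷ 9934770229 ∷ 21760182326
       ∷ 21761230903 ∷ 9800523832 ∷ 9800556601 ∷ 21626095674 ∷ 21627144251 ∷ 21558988860
       ∷ 21560037437 ∷ 27388938302 ∷ 27422492735 ∷ [])
  ∷ node (1 ∷ 2 ∷ 3 ∷ 4 ∷ 5 ∷ 8 ∷ 9 ∷ 16 ∷ 18 ∷ [])
      (11282810918 ∷ 11282843687 ∷ 11278747690 ∷ 11278780459 ∷ 14497878060 ∷ 14497910829
       ∷ 23093970990 ∷ 23095019567 ∷ 9936832561 ∷ 9936898099 ∷ 28462680116 ∷ 28462712885
       ∷ 28529788982 ∷ 28529821751 ∷ 28458616888 ∷ 28458649657 ∷ 28525725754 ∷ 28525758523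
       ∷ 29536421948 ∷ 29537470525 ∷ 29603530814 ∷ 29604579391 ∷ [])
  ∷ node (1 ∷ 2 ∷ 3 ∷ 4 ∷ 5 ∷ 8 ∷ 9 ∷ 16 ∷ 22 ∷ [])
      (12356552742 ∷ 13430327335 ∷ 15573714986 ∷ 15573747755 ∷ 15571619884 ∷ 15571652653
       ∷ 24167712814 ∷ 24168761391 ∷ 21760182321 ∷ 28529788978 ∷ 28563377203 ∷ 28596897844
       ∷ 28630486069 ∷ 21766473783 ∷ 29532168248 ∷ 29532169273 ∷ 30610163770 ∷ 30611212347
       ∷ 30811490364 ∷ 30812538941 ∷ 29733494846 ∷ 29733495871 ∷ [])
  ∷ node (1 ∷ 2 ∷ 3 ∷ 4 ∷ 5 ∷ 8 ∷ 9 ∷ 16 ∷ 30 ∷ [])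
      (16651520038 ∷ 16652601383 ∷ 16647456810 ∷ 16648538155 ∷ 16645361708 ∷ 16646443053
       ∷ 25241454638 ∷ 26316245039 ∷ 27388938289 ∷ 29603530802 ∷ 29638134835 ∷ 29670576180
       ∷ 29705180213 ∷ 29733494838 ∷ 29768098871 ∷ 29800603704 ∷ 29835207737 ∷ 29871902778
       ∷ 29906506811 ∷ 29939075132 ∷ 29973679165 ∷ 27858700351 ∷ [])
  ∷ node (1 ∷ 2 ∷ 3 ∷ 4 ∷ 5 ∷ 8 ∷ 10 ∷ 12 ∷ 15 ∷ [])
      (5916166342 ∷ 5914069223 ∷ 5910922537 ∷ 5909874027 ∷ 5910889901 ∷ 5909841358 ∷ 31683905584
       ∷ 31717460017 ∷ 31751014450 ∷ 31784568883 ∷ 31818123316 ∷ 31851677749 ∷ 31885232182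
       ∷ 31918786615 ∷ 31952341048 ∷ 31985895481 ∷ 32019449914 ∷ 32053004347 ∷ 32086558780
       ∷ 32120113213 ∷ 32153667646 ∷ 32187222079 ∷ [])
  ∷ node (1 ∷ 2 ∷ 3 ∷ 4 ∷ 5 ∷ 8 ∷ 10 ∷ 12 ∷ 16 ∷ [])
      (6987747398 ∷ 9135359047 ∷ 6983589929 ∷ 9131329579 ∷ 9129300013 ∷ 9128255566 ∷ 31683905583
       ∷ 28202633265 ∷ 28068545618 ∷ 32757647411 ∷ 28001436820 ∷ 32757583925 ∷ 33831389238
       ∷ 34905131063 ∷ 27967752472 ∷ 33827325017 ∷ 32753360986 ∷ 34901066843 ∷ 32751263900
       ∷ 34898969757 ∷ 34897791262 ∷ 35978872895 ∷ [])
  ∷ node (1 ∷ 2 ∷ 3 ∷ 4 ∷ 5 ∷ 8 ∷ 10 ∷ 16 ∷ 19 ∷ [])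
      (11282877510 ∷ 11282910279 ∷ 11278781481 ∷ 11278847019 ∷ 32757647404 ∷ 32757680173
       ∷ 32759744558 ∷ 32759777327 ∷ 11010607153 ∷ 11010639922 ∷ 32497601588 ∷ 32497634357
       ∷ 32500780086 ∷ 32500747319 ∷ 32363514968 ∷ 32366726233 ∷ 32363580506 ∷ 32366660699
       ∷ 37052614716 ∷ 37155375165 ∷ 37054711870 ∷ 37153278015 ∷ [])
  ∷ node (1 ∷ 2 ∷ 3 ∷ 4 ∷ 5 ∷ 8 ∷ 10 ∷ 16 ∷ 20 ∷ [])
      (11282714694 ∷ 12356584519 ∷ 14499973161 ∷ 14500038699 ∷ 28001436812 ∷ 32757584941
       ∷ 28001502350 ∷ 32759682095 ∷ 14229704753 ∷ 28060419154 ∷ 32497601587 ∷ 14229835829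
       ∷ 28060550230 ∷ 32501795895 ∷ 38126356536 ∷ 39200098361 ∷ 38128453690 ∷ 39202195515
       ∷ 38260574268 ∷ 39334316093 ∷ 38262671422 ∷ 39336413247 ∷ [])
  ∷ node (1 ∷ 2 ∷ 3 ∷ 4 ∷ 5 ∷ 8 ∷ 10 ∷ 16 ∷ 22 ∷ [])
      (11282782278 ∷ 13430326343 ∷ 15573714985 ∷ 15573780523 ∷ 33831389228 ∷ 34905163821
       ∷ 33833486382 ∷ 34907260975 ∷ 22833924145 ∷ 28060484690 ∷ 32500780083 ∷ 28060550228
       ∷ 32502877237 ∷ 22840215607 ∷ 39196034136 ∷ 40273840185 ∷ 39196099674 ∷ 40275937339
       ∷ 39397426268 ∷ 40477263933 ∷ 39397360734 ∷ 40475166783 ∷ [])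
  ∷ node (1 ∷ 2 ∷ 3 ∷ 4 ∷ 5 ∷ 8 ∷ 10 ∷ 16 ∷ 28 ∷ [])
      (15577681990 ∷ 16651551815 ∷ 15573524521 ∷ 16647522347 ∷ 32751263884 ∷ 34898969773
       ∷ 34897791310 ∷ 35981002799 ∷ 29276375089 ∷ 29142287442 ∷ 37052614707 ∷ 38260574260
       ∷ 39367903285 ∷ 39397426262 ∷ 40510851127 ∷ 38394791992 ∷ 39502121017 ∷ 39531643994
       ∷ 40645068859 ∷ 29288958013 ∷ 29154870366 ∷ 37455267903 ∷ [])
  ∷ node (1 ∷ 2 ∷ 3 ∷ 4 ∷ 5 ∷ 8 ∷ 14 ∷ 16 ∷ 22 ∷ [])
      (10209036486 ∷ 17725294631 ∷ 24167712809 ∷ 33833486378 ∷ 33834568747 ∷ 33835583532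
       ∷ 33836665901 ∷ 24174004271 ∷ 23907665969 ∷ 33573439538 ∷ 33574521907 ∷ 33575536692
       ∷ 33576619061 ∷ 23913957431 ∷ 41347582008 ∷ 42421323833 ∷ 43495065658 ∷ 43495099451
       ∷ 43696392252 ∷ 43696426045 ∷ 41548908606 ∷ 42622650431 ∷ [])
  ∷ node (1 ∷ 2 ∷ 3 ∷ 4 ∷ 5 ∷ 8 ∷ 14 ∷ 16 ∷ 23 ∷ [])
      (13430261958 ∷ 13170215143 ∷ 24168794153 ∷ 34907228202 ∷ 34908310571 ∷ 34909325356
       ∷ 34910407725 ∷ 24175085615 ∷ 23908714545 ∷ 34647214130 ∷ 34648230963 ∷ 34649279540
       ∷ 34650359861 ∷ 23913957430 ∷ 44568807480 ∷ 44809979961 ∷ 45642549306 ∷ 45883721787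
       ∷ 45648840764 ∷ 45877430333 ∷ 44575098942 ∷ 44803688511 ∷ [])
  ∷ node (1 ∷ 2 ∷ 3 ∷ 4 ∷ 5 ∷ 8 ∷ 14 ∷ 16 ∷ 24 ∷ [])
      (14504003782 ∷ 18799036455 ∷ 23089717289 ∷ 32753363018 ∷ 32754412651 ∷ 32751267980
       ∷ 32752317613 ∷ 25247746095 ∷ 29263740977 ∷ 38927860818 ∷ 38928909427 ∷ 38925763732
       ∷ 38926812341 ∷ 41347582006 ∷ 44568807479 ∷ 29263749177 ∷ 38928122970 ∷ 38929171579
       ∷ 38926025884 ∷ 38927074493 ∷ 41616017470 ∷ 44837242943 ∷ [])
  ∷ node (1 ∷ 2 ∷ 3 ∷ 4 ∷ 5 ∷ 8 ∷ 14 ∷ 16 ∷ 25 ∷ [])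
      (16651487430 ∷ 19872778279 ∷ 23090766889 ∷ 34901132362 ∷ 34902213739 ∷ 34899100812
       ∷ 34900182189 ∷ 26321487919 ∷ 29263742001 ∷ 40013793330 ∷ 40013827123 ∷ 40013729844
       ∷ 40013763637 ∷ 42421323830 ∷ 44809979959 ∷ 29263749176 ∷ 40023264314 ∷ 40023230523
       ∷ 40023200828 ∷ 40023167037 ∷ 45044860990 ∷ 42723313727 ∷ [])
  ∷ node (1 ∷ 2 ∷ 3 ∷ 4 ∷ 5 ∷ 8 ∷ 14 ∷ 16 ∷ 26 ∷ [])
      (15577745606 ∷ 19872777287 ∷ 24163649577 ∷ 27967752522 ∷ 33828471915 ∷ 34897791372
       ∷ 35984149549 ∷ 24161751087 ∷ 30350116913 ∷ 38927926354 ∷ 40016972851 ∷ 39127221396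
       ∷ 40220333109 ∷ 43495065654 ∷ 45642549303 ∷ 38928122968 ∷ 40023264313 ∷ 30360602683
       ∷ 43830609980 ∷ 45978093629 ∷ 39127549086 ∷ 40230818879 ∷ [])
  ∷ node (1 ∷ 2 ∷ 3 ∷ 4 ∷ 8 ∷ 12 ∷ 16 ∷ 21 ∷ 26 ∷ [])
      (37052551205 ∷ 40273743942 ∷ 40445710439 ∷ 40269586473 ∷ 37048328266 ∷ 40613519467
       ∷ 40437395501 ∷ 40609361998 ∷ 37216104559 ∷ 38926419505 ∷ 38792333906 ∷ 44296569971
       ∷ 39059588756 ∷ 38791417558 ∷ 44430951511 ∷ 39058672408 ∷ 38924586809 ∷ 44435310651
       ∷ 44092101020 ∷ 44125819165 ∷ 44127035550 ∷ 46716291135 ∷ [])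
  ∷ node (1 ∷ 2 ∷ 3 ∷ 4 ∷ 8 ∷ 13 ∷ 16 ∷ 21 ∷ 25 ∷ [])
      (22632727717 ∷ 43495064646 ∷ 43495064679 ∷ 22632596777 ∷ 43491001418 ∷ 43491001451
       ∷ 22637839756 ∷ 43658937454 ∷ 43658937423 ∷ 22624208433 ∷ 43222828114 ∷ 43222828147
       ∷ 22629451412 ∷ 43390764150 ∷ 43390764119 ∷ 22629582616 ∷ 43395089530 ∷ 43395089499
       ∷ 47790032956 ∷ 24777069501 ∷ 48863774782 ∷ 48863775807 ∷ [])
  ∷ node (1 ∷ 2 ∷ 3 ∷ 4 ∷ 8 ∷ 13 ∷ 16 ∷ 21 ∷ 26 ∷ [])
      (29075178661 ∷ 42421322822 ∷ 43495164007 ∷ 40269620265 ∷ 40192026698 ∷ 45638485099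
       ∷ 40437395500 ∷ 45806421102 ∷ 40024259663 ∷ 40001193009 ∷ 40460470354 ∷ 45370311795
       ∷ 40168968244 ∷ 45538247798 ∷ 40292703319 ∷ 29038480152 ∷ 43395089529 ∷ 42321381435
       ∷ 49031547964 ∷ 44092007357 ∷ 46466730046 ∷ 49375611999 ∷ [])
  ∷ node (1 ∷ 2 ∷ 4 ∷ 7 ∷ 8 ∷ 11 ∷ 13 ∷ 14 ∷ 16 ∷ [])
      (20946486371 ∷ 20946420901 ∷ 20946420934 ∷ 20942226729 ∷ 20942226762 ∷ 20942226828
       ∷ 20942226927 ∷ 47517351985 ∷ 47517319250 ∷ 49937516595 ∷ 47515222164 ∷ 49937453109
       ∷ 49937456182 ∷ 47515222263 ∷ 47381004568 ∷ 49933262905 ∷ 49933265978 ∷ 47381004667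
       ∷ 49933268028 ∷ 47381004733 ∷ 47381004766 ∷ 49933269055 ∷ [])
  ∷ node (1 ∷ 2 ∷ 4 ∷ 7 ∷ 8 ∷ 11 ∷ 13 ∷ 16 ∷ 19 ∷ [])
      (22020228195 ∷ 24167646373 ∷ 24170792134 ∷ 24163452201 ∷ 24166597962 ∷ 24160473484
       ∷ 49937516590 ∷ 24161522159 ∷ 43222369841 ∷ 43222369874 ∷ 43219391124 ∷ 51011258421
       ∷ 51111921718 ∷ 43219391223 ∷ 43085308696 ∷ 51007195193 ∷ 51107858490 ∷ 43085308795
       ∷ 51004054684 ∷ 48691738045 ∷ 48691739070 ∷ 51104717983 ∷ [])
  ∷ node (1 ∷ 2 ∷ 4 ∷ 7 ∷ 8 ∷ 11 ∷ 13 ∷ 16 ∷ 30 ∷ [])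
      (26315195491 ∷ 26315130021 ∷ 26318275782 ∷ 26310935849 ∷ 26314081610 ∷ 26314147212
       ∷ 47381004750 ∷ 26314148335 ∷ 48591093809 ∷ 48691724370 ∷ 48691739059 ∷ 48756736148
       ∷ 48756750709 ∷ 48756750614 ∷ 48756736247 ∷ 48756736280 ∷ 48756750585 ∷ 48756750490
       ∷ 48756736379 ∷ 48691738716 ∷ 48691724733 ∷ 48591108159 ∷ [])
  ∷ node (1 ∷ 2 ∷ 4 ∷ 7 ∷ 8 ∷ 11 ∷ 16 ∷ 19 ∷ 29 ∷ [])
      (27388937315 ∷ 42421257381 ∷ 42521920710 ∷ 42417063209 ∷ 42517726538 ∷ 42414084492
       ∷ 48691738029 ∷ 48591074766 ∷ 42514747887 ∷ 42148628017 ∷ 42249291346 ∷ 42145649300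
       ∷ 48960173749 ∷ 48859510486 ∷ 42246312695 ∷ 42011566872 ∷ 48964368185 ∷ 48863704922
       ∷ 42112230267 ∷ 48964466588 ∷ 52085000254 ∷ 48863803391 ∷ [])
  ∷ node (1 ∷ 2 ∷ 4 ∷ 7 ∷ 8 ∷ 11 ∷ 16 ∷ 21 ∷ 25 ∷ [])
      (30610162787 ∷ 30350050469 ∷ 45642482886 ∷ 30215832873 ∷ 45638288714 ∷ 30120579468
       ∷ 51005100077 ∷ 51004152910 ∷ 45803082223 ∷ 30140401201 ∷ 30110091858 ∷ 50739021875
       ∷ 45367821972 ∷ 50736045206 ∷ 45467536119 ∷ 45233735448 ∷ 50601962778 ∷ 45333449595
       ∷ 50534864412 ∷ 45138318269 ∷ 45168828382 ∷ 53158742079 ∷ [])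
  ∷ []) ∷
  -- At the last level no moves are listed: `Chain` asks for transitions only from a level that has
  -- a successor. Ten points are the largest complement used, for k = 6.
  ( node (1 ∷ 2 ∷ 3 ∷ 4 ∷ 5 ∷ 6 ∷ 7 ∷ 8 ∷ 9 ∷ 10 ∷ []) []
  ∷ node (1 ∷ 2 ∷ 3 ∷ 4 ∷ 5 ∷ 6 ∷ 7 ∷ 8 ∷ 9 ∷ 16 ∷ []) []
  ∷ node (1 ∷ 2 ∷ 3 ∷ 4 ∷ 5 ∷ 6 ∷ 7 ∷ 8 ∷ 16 ∷ 24 ∷ []) []
  ∷ node (1 ∷ 2 ∷ 3 ∷ 4 ∷ 5 ∷ 6 ∷ 7 ∷ 8 ∷ 16 ∷ 25 ∷ []) []
  ∷ node (1 ∷ 2 ∷ 3 ∷ 4 ∷ 5 ∷ 6 ∷ 8 ∷ 9 ∷ 10 ∷ 12 ∷ []) []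
  ∷ node (1 ∷ 2 ∷ 3 ∷ 4 ∷ 5 ∷ 6 ∷ 8 ∷ 9 ∷ 10 ∷ 13 ∷ []) []
  ∷ node (1 ∷ 2 ∷ 3 ∷ 4 ∷ 5 ∷ 6 ∷ 8 ∷ 9 ∷ 10 ∷ 16 ∷ []) []
  ∷ node (1 ∷ 2 ∷ 3 ∷ 4 ∷ 5 ∷ 6 ∷ 8 ∷ 9 ∷ 14 ∷ 15 ∷ []) []
  ∷ node (1 ∷ 2 ∷ 3 ∷ 4 ∷ 5 ∷ 6 ∷ 8 ∷ 9 ∷ 14 ∷ 16 ∷ []) []
  ∷ node (1 ∷ 2 ∷ 3 ∷ 4 ∷ 5 ∷ 6 ∷ 8 ∷ 9 ∷ 16 ∷ 17 ∷ []) []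
  ∷ node (1 ∷ 2 ∷ 3 ∷ 4 ∷ 5 ∷ 6 ∷ 8 ∷ 9 ∷ 16 ∷ 18 ∷ []) []
  ∷ node (1 ∷ 2 ∷ 3 ∷ 4 ∷ 5 ∷ 6 ∷ 8 ∷ 9 ∷ 16 ∷ 22 ∷ []) []
  ∷ node (1 ∷ 2 ∷ 3 ∷ 4 ∷ 5 ∷ 6 ∷ 8 ∷ 9 ∷ 16 ∷ 23 ∷ []) []
  ∷ node (1 ∷ 2 ∷ 3 ∷ 4 ∷ 5 ∷ 6 ∷ 8 ∷ 9 ∷ 16 ∷ 24 ∷ []) []
  ∷ node (1 ∷ 2 ∷ 3 ∷ 4 ∷ 5 ∷ 6 ∷ 8 ∷ 9 ∷ 16 ∷ 26 ∷ []) []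
  ∷ node (1 ∷ 2 ∷ 3 ∷ 4 ∷ 5 ∷ 6 ∷ 8 ∷ 9 ∷ 16 ∷ 30 ∷ []) []
  ∷ node (1 ∷ 2 ∷ 3 ∷ 4 ∷ 5 ∷ 6 ∷ 8 ∷ 15 ∷ 16 ∷ 23 ∷ []) []
  ∷ node (1 ∷ 2 ∷ 3 ∷ 4 ∷ 5 ∷ 6 ∷ 8 ∷ 15 ∷ 16 ∷ 24 ∷ []) []
  ∷ node (1 ∷ 2 ∷ 3 ∷ 4 ∷ 5 ∷ 6 ∷ 8 ∷ 15 ∷ 16 ∷ 25 ∷ []) []
  ∷ node (1 ∷ 2 ∷ 3 ∷ 4 ∷ 5 ∷ 8 ∷ 9 ∷ 14 ∷ 15 ∷ 16 ∷ []) []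
  ∷ node (1 ∷ 2 ∷ 3 ∷ 4 ∷ 5 ∷ 8 ∷ 9 ∷ 14 ∷ 16 ∷ 17 ∷ []) []
  ∷ node (1 ∷ 2 ∷ 3 ∷ 4 ∷ 5 ∷ 8 ∷ 9 ∷ 14 ∷ 16 ∷ 18 ∷ []) []
  ∷ node (1 ∷ 2 ∷ 3 ∷ 4 ∷ 5 ∷ 8 ∷ 9 ∷ 14 ∷ 16 ∷ 22 ∷ []) []
  ∷ node (1 ∷ 2 ∷ 3 ∷ 4 ∷ 5 ∷ 8 ∷ 9 ∷ 14 ∷ 16 ∷ 30 ∷ []) []
  ∷ node (1 ∷ 2 ∷ 3 ∷ 4 ∷ 5 ∷ 8 ∷ 9 ∷ 14 ∷ 16 ∷ 31 ∷ []) []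
  ∷ node (1 ∷ 2 ∷ 3 ∷ 4 ∷ 5 ∷ 8 ∷ 9 ∷ 16 ∷ 17 ∷ 30 ∷ []) []
  ∷ node (1 ∷ 2 ∷ 3 ∷ 4 ∷ 5 ∷ 8 ∷ 9 ∷ 16 ∷ 18 ∷ 20 ∷ []) []
  ∷ node (1 ∷ 2 ∷ 3 ∷ 4 ∷ 5 ∷ 8 ∷ 9 ∷ 16 ∷ 18 ∷ 28 ∷ []) []
  ∷ node (1 ∷ 2 ∷ 3 ∷ 4 ∷ 5 ∷ 8 ∷ 9 ∷ 16 ∷ 22 ∷ 26 ∷ []) []
  ∷ node (1 ∷ 2 ∷ 3 ∷ 4 ∷ 5 ∷ 8 ∷ 10 ∷ 12 ∷ 15 ∷ 16 ∷ []) []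
  ∷ node (1 ∷ 2 ∷ 3 ∷ 4 ∷ 5 ∷ 8 ∷ 10 ∷ 12 ∷ 16 ∷ 19 ∷ []) []
  ∷ node (1 ∷ 2 ∷ 3 ∷ 4 ∷ 5 ∷ 8 ∷ 10 ∷ 12 ∷ 16 ∷ 22 ∷ []) []
  ∷ node (1 ∷ 2 ∷ 3 ∷ 4 ∷ 5 ∷ 8 ∷ 10 ∷ 12 ∷ 16 ∷ 23 ∷ []) []
  ∷ node (1 ∷ 2 ∷ 3 ∷ 4 ∷ 5 ∷ 8 ∷ 10 ∷ 12 ∷ 16 ∷ 31 ∷ []) []
  ∷ node (1 ∷ 2 ∷ 3 ∷ 4 ∷ 5 ∷ 8 ∷ 10 ∷ 16 ∷ 19 ∷ 28 ∷ []) []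
  ∷ node (1 ∷ 2 ∷ 3 ∷ 4 ∷ 5 ∷ 8 ∷ 10 ∷ 16 ∷ 20 ∷ 24 ∷ []) []
  ∷ node (1 ∷ 2 ∷ 3 ∷ 4 ∷ 5 ∷ 8 ∷ 10 ∷ 16 ∷ 20 ∷ 25 ∷ []) []
  ∷ node (1 ∷ 2 ∷ 3 ∷ 4 ∷ 5 ∷ 8 ∷ 10 ∷ 16 ∷ 22 ∷ 25 ∷ []) []
  ∷ node (1 ∷ 2 ∷ 3 ∷ 4 ∷ 5 ∷ 8 ∷ 14 ∷ 16 ∷ 22 ∷ 24 ∷ []) []
  ∷ node (1 ∷ 2 ∷ 3 ∷ 4 ∷ 5 ∷ 8 ∷ 14 ∷ 16 ∷ 22 ∷ 25 ∷ []) []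
  ∷ node (1 ∷ 2 ∷ 3 ∷ 4 ∷ 5 ∷ 8 ∷ 14 ∷ 16 ∷ 22 ∷ 26 ∷ []) []
  ∷ node (1 ∷ 2 ∷ 3 ∷ 4 ∷ 5 ∷ 8 ∷ 14 ∷ 16 ∷ 23 ∷ 24 ∷ []) []
  ∷ node (1 ∷ 2 ∷ 3 ∷ 4 ∷ 5 ∷ 8 ∷ 14 ∷ 16 ∷ 23 ∷ 26 ∷ []) []
  ∷ node (1 ∷ 2 ∷ 3 ∷ 4 ∷ 8 ∷ 12 ∷ 16 ∷ 21 ∷ 26 ∷ 31 ∷ []) []
  ∷ node (1 ∷ 2 ∷ 3 ∷ 4 ∷ 8 ∷ 13 ∷ 16 ∷ 21 ∷ 25 ∷ 28 ∷ []) []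
  ∷ node (1 ∷ 2 ∷ 3 ∷ 4 ∷ 8 ∷ 13 ∷ 16 ∷ 21 ∷ 25 ∷ 30 ∷ []) []
  ∷ node (1 ∷ 2 ∷ 4 ∷ 7 ∷ 8 ∷ 11 ∷ 13 ∷ 14 ∷ 16 ∷ 19 ∷ []) []
  ∷ node (1 ∷ 2 ∷ 4 ∷ 7 ∷ 8 ∷ 11 ∷ 13 ∷ 16 ∷ 19 ∷ 21 ∷ []) []
  ∷ node (1 ∷ 2 ∷ 4 ∷ 7 ∷ 8 ∷ 11 ∷ 16 ∷ 19 ∷ 29 ∷ 30 ∷ []) []
  ∷ node (1 ∷ 2 ∷ 4 ∷ 7 ∷ 8 ∷ 11 ∷ 16 ∷ 21 ∷ 25 ∷ 31 ∷ []) []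
  ∷ []) ∷
  []

-- Packings for the orbit representatives

-- Up to GL(5,2), every 6-point cap contains one of these zero-sum sets of 4, 5 or 6 points.
packings₁ : List (List (List V))
packings₁ = map (map points)
  ( ((1 ∷ 2 ∷ 4 ∷ 7 ∷ []) ∷ [])
  ∷ ((1 ∷ 2 ∷ 4 ∷ 8 ∷ 15 ∷ []) ∷ [])
  ∷ ((1 ∷ 2 ∷ 4 ∷ 8 ∷ 16 ∷ 31 ∷ []) ∷ [])
  ∷ [])

packings₂ : List (List (List V))
packings₂ = map (map points)
  ( ((1 ∷ 2 ∷ 4 ∷ 7 ∷ []) ∷ (8 ∷ 11 ∷ 16 ∷ 19 ∷ []) ∷ [])
  ∷ ((1 ∷ 2 ∷ 4 ∷ 7 ∷ []) ∷ (8 ∷ 11 ∷ 16 ∷ 21 ∷ 25 ∷ 31 ∷ []) ∷ [])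
  ∷ [])

packings₃ : List (List (List V))
packings₃ = map (map points)
  ( ((1 ∷ 2 ∷ 4 ∷ 7 ∷ []) ∷ (8 ∷ 11 ∷ 16 ∷ 19 ∷ []) ∷ (13 ∷ 14 ∷ 21 ∷ 22 ∷ []) ∷ [])
  ∷ [])

packings₄ : List (List (List V))
packings₄ = map (map points)
  ( ((1 ∷ 11 ∷ 19 ∷ 25 ∷ []) ∷ (2 ∷ 7 ∷ 26 ∷ 31 ∷ []) ∷ (4 ∷ 8 ∷ 16 ∷ 28 ∷ []) ∷ (13 ∷ 14 ∷ 21 ∷ 22 ∷ [])
     ∷ [])
  ∷ [])

-- From here on the blocks avoid the representative, whereas the blocks of the preceding tables lie
-- inside it.
packings₆ : List (List (List V))
packings₆ = map (map points)
  ( ((7 ∷ 26 ∷ 29 ∷ []) ∷ (10 ∷ 22 ∷ 28 ∷ []) ∷ (11 ∷ 19 ∷ 24 ∷ []) ∷ (12 ∷ 21 ∷ 25 ∷ []) ∷ (13 ∷ 18 ∷ 31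
     ∷ []) ∷ (15 ∷ 20 ∷ 27 ∷ []) ∷ [])
  ∷ ((7 ∷ 26 ∷ 29 ∷ []) ∷ (10 ∷ 17 ∷ 27 ∷ []) ∷ (11 ∷ 20 ∷ 31 ∷ []) ∷ (12 ∷ 21 ∷ 25 ∷ []) ∷ (13 ∷ 19 ∷ 30
     ∷ []) ∷ (15 ∷ 23 ∷ 24 ∷ []) ∷ [])
  ∷ ((10 ∷ 23 ∷ 29 ∷ []) ∷ (11 ∷ 20 ∷ 31 ∷ []) ∷ (12 ∷ 21 ∷ 25 ∷ []) ∷ (13 ∷ 22 ∷ 27 ∷ []) ∷ (14 ∷ 18
     ∷ 28 ∷ []) ∷ (15 ∷ 17 ∷ 30 ∷ []) ∷ [])
  ∷ ((6 ∷ 24 ∷ 30 ∷ []) ∷ (7 ∷ 17 ∷ 22 ∷ []) ∷ (9 ∷ 20 ∷ 29 ∷ []) ∷ (11 ∷ 18 ∷ 25 ∷ []) ∷ (13 ∷ 23 ∷ 26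
     ∷ []) ∷ (14 ∷ 21 ∷ 27 ∷ []) ∷ [])
  ∷ ((6 ∷ 11 ∷ 13 ∷ []) ∷ (7 ∷ 25 ∷ 30 ∷ []) ∷ (9 ∷ 18 ∷ 27 ∷ []) ∷ (10 ∷ 21 ∷ 31 ∷ []) ∷ (12 ∷ 17 ∷ 29
     ∷ []) ∷ (15 ∷ 19 ∷ 28 ∷ []) ∷ [])
  ∷ ((9 ∷ 20 ∷ 29 ∷ []) ∷ (10 ∷ 17 ∷ 27 ∷ []) ∷ (11 ∷ 21 ∷ 30 ∷ []) ∷ (12 ∷ 19 ∷ 31 ∷ []) ∷ (13 ∷ 23 ∷ 26
     ∷ []) ∷ (14 ∷ 18 ∷ 28 ∷ []) ∷ [])
  ∷ ((7 ∷ 27 ∷ 28 ∷ []) ∷ (10 ∷ 21 ∷ 31 ∷ []) ∷ (11 ∷ 22 ∷ 29 ∷ []) ∷ (12 ∷ 20 ∷ 24 ∷ []) ∷ (13 ∷ 19 ∷ 30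
     ∷ []) ∷ (17 ∷ 18 ∷ 25 ∷ 26 ∷ []) ∷ [])
  ∷ ((6 ∷ 27 ∷ 29 ∷ []) ∷ (7 ∷ 19 ∷ 20 ∷ []) ∷ (9 ∷ 21 ∷ 28 ∷ []) ∷ (11 ∷ 17 ∷ 26 ∷ []) ∷ (13 ∷ 18 ∷ 31
     ∷ []) ∷ (15 ∷ 23 ∷ 24 ∷ []) ∷ [])
  ∷ ((11 ∷ 17 ∷ 26 ∷ []) ∷ (12 ∷ 20 ∷ 24 ∷ []) ∷ (13 ∷ 18 ∷ 31 ∷ []) ∷ (14 ∷ 19 ∷ 29 ∷ []) ∷ (15 ∷ 22
     ∷ 25 ∷ []) ∷ (21 ∷ 23 ∷ 28 ∷ 30 ∷ []) ∷ [])
  ∷ ((6 ∷ 27 ∷ 29 ∷ []) ∷ (7 ∷ 18 ∷ 21 ∷ []) ∷ (10 ∷ 19 ∷ 25 ∷ []) ∷ (11 ∷ 23 ∷ 28 ∷ []) ∷ (12 ∷ 20 ∷ 24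
     ∷ []) ∷ (15 ∷ 17 ∷ 30 ∷ []) ∷ [])
  ∷ ((6 ∷ 17 ∷ 23 ∷ []) ∷ (7 ∷ 9 ∷ 14 ∷ []) ∷ (11 ∷ 21 ∷ 30 ∷ []) ∷ (12 ∷ 22 ∷ 26 ∷ []) ∷ (13 ∷ 18 ∷ 31
     ∷ []) ∷ (15 ∷ 19 ∷ 28 ∷ []) ∷ [])
  ∷ ((5 ∷ 18 ∷ 23 ∷ []) ∷ (6 ∷ 10 ∷ 12 ∷ []) ∷ (7 ∷ 26 ∷ 29 ∷ []) ∷ (11 ∷ 19 ∷ 24 ∷ []) ∷ (14 ∷ 17 ∷ 31
     ∷ []) ∷ (15 ∷ 20 ∷ 27 ∷ []) ∷ [])
  ∷ ((3 ∷ 28 ∷ 31 ∷ []) ∷ (5 ∷ 17 ∷ 20 ∷ []) ∷ (6 ∷ 27 ∷ 29 ∷ []) ∷ (9 ∷ 23 ∷ 30 ∷ []) ∷ (10 ∷ 18 ∷ 24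
     ∷ []) ∷ (15 ∷ 22 ∷ 25 ∷ []) ∷ [])
  ∷ ((9 ∷ 20 ∷ 29 ∷ []) ∷ (10 ∷ 17 ∷ 27 ∷ []) ∷ (12 ∷ 18 ∷ 30 ∷ []) ∷ (13 ∷ 23 ∷ 26 ∷ []) ∷ (14 ∷ 22 ∷ 24
     ∷ []) ∷ (15 ∷ 19 ∷ 28 ∷ []) ∷ [])
  ∷ ((7 ∷ 24 ∷ 31 ∷ []) ∷ (11 ∷ 17 ∷ 18 ∷ 19 ∷ 27 ∷ []) ∷ (13 ∷ 16 ∷ 29 ∷ []) ∷ (14 ∷ 23 ∷ 25 ∷ []) ∷ (15
     ∷ 21 ∷ 26 ∷ []) ∷ (20 ∷ 22 ∷ 28 ∷ 30 ∷ []) ∷ [])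
  ∷ ((7 ∷ 27 ∷ 28 ∷ []) ∷ (11 ∷ 20 ∷ 31 ∷ []) ∷ (12 ∷ 17 ∷ 29 ∷ []) ∷ (14 ∷ 16 ∷ 30 ∷ []) ∷ (15 ∷ 23 ∷ 24
     ∷ []) ∷ (21 ∷ 22 ∷ 25 ∷ 26 ∷ []) ∷ [])
  ∷ ((7 ∷ 24 ∷ 31 ∷ []) ∷ (11 ∷ 21 ∷ 30 ∷ []) ∷ (12 ∷ 23 ∷ 27 ∷ []) ∷ (13 ∷ 17 ∷ 28 ∷ []) ∷ (14 ∷ 19 ∷ 29
     ∷ []) ∷ (15 ∷ 22 ∷ 25 ∷ []) ∷ [])
  ∷ ((6 ∷ 24 ∷ 30 ∷ []) ∷ (7 ∷ 19 ∷ 20 ∷ []) ∷ (9 ∷ 21 ∷ 28 ∷ []) ∷ (11 ∷ 18 ∷ 25 ∷ []) ∷ (13 ∷ 22 ∷ 27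
     ∷ []) ∷ (14 ∷ 17 ∷ 31 ∷ []) ∷ [])
  ∷ ((5 ∷ 27 ∷ 30 ∷ []) ∷ (6 ∷ 9 ∷ 15 ∷ []) ∷ (10 ∷ 23 ∷ 29 ∷ []) ∷ (11 ∷ 19 ∷ 24 ∷ []) ∷ (13 ∷ 20 ∷ 25
     ∷ []) ∷ (14 ∷ 18 ∷ 28 ∷ []) ∷ [])
  ∷ ((3 ∷ 25 ∷ 26 ∷ []) ∷ (5 ∷ 17 ∷ 20 ∷ []) ∷ (6 ∷ 15 ∷ 22 ∷ 31 ∷ []) ∷ (9 ∷ 21 ∷ 28 ∷ []) ∷ (10 ∷ 18
     ∷ 24 ∷ []) ∷ (12 ∷ 23 ∷ 27 ∷ []) ∷ [])
  ∷ [])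

packings₇ : List (List (List V))
packings₇ = map (map points)
  ( ((6 ∷ 19 ∷ 21 ∷ []) ∷ (7 ∷ 27 ∷ 28 ∷ []) ∷ (10 ∷ 23 ∷ 29 ∷ []) ∷ (11 ∷ 17 ∷ 26 ∷ []) ∷ (12 ∷ 20 ∷ 24
     ∷ []) ∷ (13 ∷ 18 ∷ 31 ∷ []) ∷ (15 ∷ 22 ∷ 25 ∷ []) ∷ [])
  ∷ ((9 ∷ 21 ∷ 28 ∷ []) ∷ (10 ∷ 19 ∷ 25 ∷ []) ∷ (11 ∷ 22 ∷ 29 ∷ []) ∷ (12 ∷ 23 ∷ 27 ∷ []) ∷ (13 ∷ 18 ∷ 31
     ∷ []) ∷ (14 ∷ 20 ∷ 26 ∷ []) ∷ (15 ∷ 17 ∷ 30 ∷ []) ∷ [])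
  ∷ ((6 ∷ 19 ∷ 21 ∷ []) ∷ (7 ∷ 27 ∷ 28 ∷ []) ∷ (11 ∷ 22 ∷ 29 ∷ []) ∷ (12 ∷ 20 ∷ 24 ∷ []) ∷ (13 ∷ 18 ∷ 31
     ∷ []) ∷ (14 ∷ 23 ∷ 25 ∷ []) ∷ (15 ∷ 17 ∷ 30 ∷ []) ∷ [])
  ∷ ((5 ∷ 27 ∷ 30 ∷ []) ∷ (6 ∷ 26 ∷ 28 ∷ []) ∷ (7 ∷ 9 ∷ 14 ∷ []) ∷ (10 ∷ 19 ∷ 25 ∷ []) ∷ (11 ∷ 20 ∷ 31
     ∷ []) ∷ (12 ∷ 17 ∷ 29 ∷ []) ∷ (15 ∷ 23 ∷ 24 ∷ []) ∷ [])
  ∷ ((5 ∷ 19 ∷ 22 ∷ []) ∷ (6 ∷ 26 ∷ 28 ∷ []) ∷ (9 ∷ 18 ∷ 27 ∷ []) ∷ (10 ∷ 20 ∷ 30 ∷ []) ∷ (12 ∷ 21 ∷ 25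
     ∷ []) ∷ (14 ∷ 17 ∷ 31 ∷ []) ∷ (15 ∷ 23 ∷ 24 ∷ []) ∷ [])
  ∷ ((7 ∷ 17 ∷ 22 ∷ []) ∷ (10 ∷ 16 ∷ 26 ∷ []) ∷ (11 ∷ 23 ∷ 28 ∷ []) ∷ (12 ∷ 20 ∷ 24 ∷ []) ∷ (13 ∷ 19 ∷ 30
     ∷ []) ∷ (14 ∷ 21 ∷ 27 ∷ []) ∷ (15 ∷ 18 ∷ 29 ∷ []) ∷ [])
  ∷ ((7 ∷ 16 ∷ 23 ∷ []) ∷ (9 ∷ 13 ∷ 17 ∷ 21 ∷ []) ∷ (10 ∷ 20 ∷ 30 ∷ []) ∷ (11 ∷ 19 ∷ 24 ∷ []) ∷ (12 ∷ 22
     ∷ 26 ∷ []) ∷ (14 ∷ 18 ∷ 28 ∷ []) ∷ (25 ∷ 27 ∷ 29 ∷ 31 ∷ []) ∷ [])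
  ∷ ((6 ∷ 19 ∷ 21 ∷ []) ∷ (7 ∷ 26 ∷ 29 ∷ []) ∷ (9 ∷ 22 ∷ 31 ∷ []) ∷ (11 ∷ 16 ∷ 27 ∷ []) ∷ (13 ∷ 20 ∷ 25
     ∷ []) ∷ (14 ∷ 18 ∷ 28 ∷ []) ∷ (15 ∷ 23 ∷ 24 ∷ []) ∷ [])
  ∷ ((6 ∷ 9 ∷ 11 ∷ 18 ∷ 22 ∷ []) ∷ (7 ∷ 27 ∷ 28 ∷ []) ∷ (10 ∷ 21 ∷ 31 ∷ []) ∷ (12 ∷ 20 ∷ 24 ∷ []) ∷ (13
     ∷ 23 ∷ 26 ∷ []) ∷ (14 ∷ 19 ∷ 29 ∷ []) ∷ (15 ∷ 17 ∷ 30 ∷ []) ∷ [])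
  ∷ ((5 ∷ 11 ∷ 14 ∷ []) ∷ (6 ∷ 26 ∷ 28 ∷ []) ∷ (7 ∷ 24 ∷ 31 ∷ []) ∷ (9 ∷ 23 ∷ 30 ∷ []) ∷ (10 ∷ 19 ∷ 25
     ∷ []) ∷ (13 ∷ 22 ∷ 27 ∷ []) ∷ (15 ∷ 18 ∷ 29 ∷ []) ∷ [])
  ∷ ((3 ∷ 5 ∷ 6 ∷ []) ∷ (9 ∷ 21 ∷ 28 ∷ []) ∷ (10 ∷ 19 ∷ 25 ∷ []) ∷ (12 ∷ 22 ∷ 26 ∷ []) ∷ (15 ∷ 17 ∷ 30
     ∷ []) ∷ (16 ∷ 20 ∷ 27 ∷ 31 ∷ []) ∷ (18 ∷ 23 ∷ 24 ∷ 29 ∷ []) ∷ [])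
  ∷ ((3 ∷ 24 ∷ 27 ∷ []) ∷ (5 ∷ 25 ∷ 28 ∷ []) ∷ (6 ∷ 10 ∷ 12 ∷ []) ∷ (9 ∷ 23 ∷ 30 ∷ []) ∷ (13 ∷ 18 ∷ 20
     ∷ 22 ∷ 29 ∷ []) ∷ (14 ∷ 17 ∷ 31 ∷ []) ∷ (15 ∷ 21 ∷ 26 ∷ []) ∷ [])
  ∷ ((3 ∷ 17 ∷ 18 ∷ []) ∷ (5 ∷ 27 ∷ 30 ∷ []) ∷ (6 ∷ 26 ∷ 28 ∷ []) ∷ (10 ∷ 23 ∷ 29 ∷ []) ∷ (12 ∷ 19 ∷ 31
     ∷ []) ∷ (13 ∷ 20 ∷ 25 ∷ []) ∷ (14 ∷ 22 ∷ 24 ∷ []) ∷ [])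
  ∷ [])

-- There are two orbits of triples. The complement of a line splits into eight lines and a
-- quadruple; the complement of a triangle contains nine disjoint lines.
packings₉ : List (List (List V))
packings₉ = map (map points)
  ( ((4 ∷ 8 ∷ 12 ∷ []) ∷ (5 ∷ 24 ∷ 29 ∷ []) ∷ (6 ∷ 18 ∷ 20 ∷ []) ∷ (7 ∷ 9 ∷ 14 ∷ []) ∷ (10 ∷ 21 ∷ 31
     ∷ []) ∷ (11 ∷ 16 ∷ 27 ∷ []) ∷ (13 ∷ 23 ∷ 26 ∷ []) ∷ (15 ∷ 22 ∷ 25 ∷ []) ∷ (17 ∷ 19 ∷ 28 ∷ 30
     ∷ []) ∷ [])
  ∷ ((3 ∷ 20 ∷ 23 ∷ []) ∷ (5 ∷ 8 ∷ 13 ∷ []) ∷ (6 ∷ 27 ∷ 29 ∷ []) ∷ (9 ∷ 17 ∷ 24 ∷ []) ∷ (10 ∷ 19 ∷ 25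
     ∷ []) ∷ (11 ∷ 21 ∷ 30 ∷ []) ∷ (12 ∷ 22 ∷ 26 ∷ []) ∷ (14 ∷ 18 ∷ 28 ∷ []) ∷ (15 ∷ 16 ∷ 31 ∷ [])
     ∷ [])
  ∷ [])

-- A partition of all 31 points into nine lines and a quadruple.
packings₁₀ : List (List (List V))
packings₁₀ = map (map points)
  ( ((1 ∷ 16 ∷ 17 ∷ []) ∷ (2 ∷ 12 ∷ 14 ∷ []) ∷ (3 ∷ 11 ∷ 21 ∷ 29 ∷ []) ∷ (4 ∷ 26 ∷ 30 ∷ []) ∷ (5 ∷ 25
     ∷ 28 ∷ []) ∷ (6 ∷ 9 ∷ 15 ∷ []) ∷ (7 ∷ 19 ∷ 20 ∷ []) ∷ (8 ∷ 23 ∷ 31 ∷ []) ∷ (10 ∷ 18 ∷ 24 ∷ [])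
     ∷ (13 ∷ 22 ∷ 27 ∷ []) ∷ [])
  ∷ [])

-- Evaluation of the tables, and the upper bound for each k

cap-chain : Caps.Chain 0 (([] , cap-root) ∷ []) cap-levels
cap-chain = toWitness {a? = Caps.chain? 0 (([] , cap-root) ∷ []) cap-levels} _

set-chain : Sets.Chain 0 (([] , set-root) ∷ []) set-levels
set-chain = toWitness {a? = Sets.chain? 0 (([] , set-root) ∷ []) set-levels} _

inside? : ∀ r x → Dec (Inside r x)
inside? r x = x ∈? r

avoiding? : ∀ r x → Dec (Avoiding r x)
avoiding? r x = ¬? (x ≟ 𝟎) ×-dec ¬? (x ∈? r)

cap-bound-by-evaluation : ∀ {k n} i Ps
  {_ : True (i ℕ.≤? length cap-levels)} {_ : True (i ℕ.≤? 3 + n)}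
  {_ : True (allPacked? (suc k) inside? (Caps.level (([] , cap-root) ∷ []) cap-levels i) Ps)} →
  Upper k n → Upper (suc k) (3 + n)
cap-bound-by-evaluation i Ps {i≤} {i≤n} {packed} =
  cap-bound cap-chain i {Ps} (toWitness i≤) (toWitness i≤n) (toWitness packed)

complement-bound-by-evaluation : ∀ {k n} i Ps
  {_ : True (i ℕ.≤? length set-levels)} {_ : True (i + (2 + n) ℕ.≟ 31)}
  {_ : True (allPacked? (suc k) avoiding? (Sets.level (([] , set-root) ∷ []) set-levels i) Ps)} →
  Upper k n → Upper (suc k) (2 + n)
complement-bound-by-evaluation i Ps {i≤} {i+n≡31} {packed} =
  complement-bound set-chain i {Ps} (toWitness i≤) (toWitness i+n≡31) (toWitness packed)

upper₁ : Upper 1 6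
upper₁ = cap-bound-by-evaluation 6 packings₁ (λ _ _ → none)

upper₂ : Upper 2 10
-- The bound rises by 4 here but `cap-bound` adds 3, hence the weakening from 6 to 7.
upper₂ = cap-bound-by-evaluation 10 packings₂ (Upper-mono (ℕ.n≤1+n 6) upper₁)

upper₃ : Upper 3 13
upper₃ = cap-bound-by-evaluation 13 packings₃ upper₂

upper₄ : Upper 4 16
upper₄ = cap-bound-by-evaluation 16 packings₄ upper₃

upper₅ : Upper 5 19
-- Level 17 is empty, so 19 points always contain a line and the list of packings is empty; likewise
-- for the 26 points at k = 8.
upper₅ = cap-bound-by-evaluation 17 [] upper₄

upper₆ : Upper 6 21
-- The levels 10, 8 and 3 for k = 6, 7 and 9 are the complement sizes of 21, 23 and 28 points.
upper₆ = complement-bound-by-evaluation 10 packings₆ upper₅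

upper₇ : Upper 7 23
upper₇ = complement-bound-by-evaluation 8 packings₇ upper₆

upper₈ : Upper 8 26
upper₈ = cap-bound-by-evaluation 17 [] upper₇

upper₉ : Upper 9 28
upper₉ = complement-bound-by-evaluation 3 packings₉ upper₈

upper₁₀₊ : ∀ m → Upper (10 + m) (31 + m * 2)
-- Level 0 is the empty complement: 31 points are all of them. The bound rises by 3 while
-- `complement-bound` adds 2, hence the weakening from 28 to 29.
upper₁₀₊ zero    = complement-bound-by-evaluation 0 packings₁₀ (Upper-mono (ℕ.n≤1+n 28) upper₉)
upper₁₀₊ (suc m) = beyond-bound (s≤s (ℕ.m≤n⇒m≤1+n (ℕ.m≤m+n 31 (m * 2)))) (upper₁₀₊ m)

-- Lower bounds

weight : (V → ℕ) → List V → ℕ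
weight w []      = 0
weight w (x ∷ S) = w x + weight w S

module _ (w : V → ℕ) where

  weight-++ : ∀ S T → weight w (S ++ T) ≡ weight w S + weight w T
  weight-++ []      T = refl
  weight-++ (x ∷ S) T =
    ≡.trans (cong (w x +_) (weight-++ S T)) (sym (ℕ.+-assoc (w x) (weight w S) (weight w T)))

  weight-↭ : ∀ {S T} → S ↭ T → weight w S ≡ weight w T
  weight-↭ refl        = refl
  weight-↭ (prep x p)  = cong (w x +_) (weight-↭ p)
  weight-↭ (swap {ys = T} x y p) = begin
    w x + (w y + _)           ≡⟨ cong (λ t → w x + (w y + t)) (weight-↭ p) ⟩
    w x + (w y + weight w T)  ≡⟨ ℕ.+-assoc (w x) (w y) (weight w T) ⟨
    w x + w y + weight w T    ≡⟨ cong (_+ weight w T) (ℕ.+-comm (w x) (w y)) ⟩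
    w y + w x + weight w T    ≡⟨ ℕ.+-assoc (w y) (w x) (weight w T) ⟩
    w y + (w x + weight w T)  ∎
    where open ≡-Reasoning
  weight-↭ (trans p q) = ≡.trans (weight-↭ p) (weight-↭ q)

  weight-replicate : ∀ n x → weight w (replicate n x) ≡ n * w x
  weight-replicate zero    x = refl
  weight-replicate (suc n) x = cong (w x +_) (weight-replicate n x)

  weight-≥ : ∀ {μ} → (∀ x → μ ≤ w x) → ∀ S → length S * μ ≤ weight w S
  weight-≥ μ≤w []      = z≤n
  weight-≥ μ≤w (x ∷ S) = ℕ.+-mono-≤ (μ≤w x) (weight-≥ μ≤w S)

Split : ℕ → List V → Set
Split k S = ∃[ Ts ] ∃[ R ] length Ts ≡ k × All ZeroSum Ts × S ↭ concat Ts ++ R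

Heavy : (V → ℕ) → ℕ → List V → Set
Heavy w c S = ∀ {T R} → ZeroSum T → S ↭ T ++ R → c ≤ weight w T

-- Weights add up over the blocks and the remainder. The induction moves the first block into the
-- remainder, so that `S`, and with it `Heavy`, stays the same.
heavy-bound : ∀ {w c S} → Heavy w c S → ∀ Ts {R} → All ZeroSum Ts → S ↭ concat Ts ++ R →
              length Ts * c + weight w R ≤ weight w S
heavy-bound {w} heavy [] [] p = ℕ.≤-reflexive (sym (weight-↭ w p))
heavy-bound {w} {c} {S} heavy (T ∷ Ts) {R} (z ∷ zs) p = begin
  c + k * c + weight w R             ≤⟨ ℕ.+-monoˡ-≤ (weight w R) (ℕ.+-monoˡ-≤ (k * c) (heavy z S↭)) ⟩
  weight w T + k * c + weight w R    ≡⟨ cong (_+ weight w R) (ℕ.+-comm (weight w T) (k * c)) ⟩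
  k * c + weight w T + weight w R    ≡⟨ ℕ.+-assoc (k * c) (weight w T) (weight w R) ⟩
  k * c + (weight w T + weight w R)  ≡⟨ cong (k * c +_) (weight-++ w T R) ⟨
  k * c + weight w (T ++ R)          ≤⟨ heavy-bound heavy Ts zs (↭-trans S↭ (shifts T (concat Ts))) ⟩
  weight w S                         ∎
  where
  open ℕ.≤-Reasoning
  k : ℕ
  k = length Ts
  S↭ : S ↭ T ++ (concat Ts ++ R)
  S↭ = ↭-trans p (↭-reflexive (++-assoc T (concat Ts) R))

sum-concat : ∀ {Ts} → All ZeroSum Ts → sum (concat Ts) ≡ 𝟎
sum-concat [] = refl
sum-concat {T ∷ Ts} ((_ , eq) ∷ zs) =
  ≡.trans (sum-++ T (concat Ts)) (≡.trans (cong₂ _⊕_ eq (sum-concat zs)) (⊕-self 𝟎))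

-- The remainder has the same sum as `S` and weighs less than `2 * μ`, so it has at most one term.
-- The sum of `S` would then be zero or a term of `S`.
no-split : ∀ {w c μ S k} → Heavy w c S → (∀ x → μ ≤ w x) → weight w S < k * c + 2 * μ →
           sum S ≢ 𝟎 → sum S ∉ S → ¬ Split k S
no-split {w} {c} {μ} {S} heavy μ≤w small S≢𝟎 S∌ (Ts , R , refl , zs , p) = leftover R p sum-R small-R
  where
  sum-R : sum S ≡ sum R
  sum-R = ≡.trans (sum-↭ p) (≡.trans (sum-++ (concat Ts) R)
    (≡.trans (cong (_⊕ sum R) (sum-concat zs)) (⊕-identityˡ (sum R))))
  small-R : weight w R < 2 * μ
  small-R = ℕ.+-cancelˡ-< (length Ts * c) _ _ (ℕ.≤-<-trans (heavy-bound heavy Ts zs p) small)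
  leftover : ∀ R → S ↭ concat Ts ++ R → sum S ≡ sum R → weight w R < 2 * μ → _
  leftover []          _ s≡ _ = S≢𝟎 s≡
  leftover (x ∷ [])    p s≡ _ = S∌ (subst (_∈ S) (≡.trans (sym (⊕-identityʳ x)) (sym s≡))
    (∈-resp-↭ (↭-sym (↭-trans p (shift x (concat Ts) []))) (here refl)))
  leftover (x ∷ y ∷ R) _ _ R< = ℕ.<⇒≱ R<
    (ℕ.≤-trans (ℕ.*-monoˡ-≤ μ (ℕ.m≤m+n 2 (length R))) (weight-≥ w μ≤w (x ∷ y ∷ R)))

∈-replicate⁻ : ∀ {x y : V} n → x ∈ replicate n y → x ≡ y
∈-replicate⁻ n = All.lookup (All.replicate⁺ {P = _≡ _} n refl)

-- Of two equal terms at most one comes from `U`, whose terms are distinct; the other is a copy of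
-- `g`.
repeated : ∀ {U n g x R} → Unique U → U ++ replicate n g ↭ x ∷ x ∷ R → x ≡ g
repeated {U} {n} {g} {x} {R} U! p with ∈-++⁻ U (∈-resp-↭ (↭-sym p) (here refl))
... | inj₂ x∈rep = ∈-replicate⁻ n x∈rep
... | inj₁ x∈U with ∈-∃++ x∈U
...   | as , bs , refl = second (∈-++⁻ (as ++ bs) (∈-resp-↭ (↭-sym (drop-∷ p′)) (here refl)))
  where
  p′ : x ∷ (as ++ bs) ++ replicate n g ↭ x ∷ x ∷ R
  p′ = ↭-trans (↭-sym (++⁺ʳ (replicate n g) (shift x as bs))) p
  second : x ∈ as ++ bs ⊎ x ∈ replicate n g → x ≡ g
  second (inj₁ x∈)
    with x∉ ∷ _ ← Permutationₛ.Unique-resp-↭ (≡.setoid V) (↭⇒↭ₛ (shift x as bs)) U!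
    = contradiction refl (All.lookup x∉ x∈)
  second (inj₂ x∈rep) = ∈-replicate⁻ n x∈rep

-- The two weightings and the sequences they apply to

-- The fields treat zero-sum subsequences by length: `triple` for three terms, `min` with `four` for
-- more. A single term is nonzero, and a pair consists of two terms equal to the repeated point `g`,
-- for which `c ≤ w g + w g` is required separately.
record Weighting (c μ : ℕ) : Set where
  field
    w      : V → ℕ
    min    : ∀ x → μ ≤ w x
    triple : ∀ x y z → sum (x ∷ y ∷ z ∷ []) ≡ 𝟎 → c ≤ weight w (x ∷ y ∷ z ∷ [])
    four   : c ≤ 4 * μ

open Weighting using (w)

heavy : ∀ {c μ} (W : Weighting c μ) {U} n {g} → Simple U → g ≢ 𝟎 → c ≤ w W g + w W g →
        Heavy (w W) c (U ++ replicate n g)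
heavy {c} {μ} W {U} n {g} (U! , U≢𝟎) g≢𝟎 c≤2g = go _
  where
  open Weighting W hiding (w)
  go : ∀ T {R} → ZeroSum T → U ++ replicate n g ↭ T ++ R → c ≤ weight (w W) T
  go [] (T≢[] , _) _ = contradiction refl T≢[]
  go (x ∷ []) (_ , eq) p = contradiction (≡.trans (sym (⊕-identityʳ x)) eq)
    (All.head (All-resp-↭ p (All.++⁺ U≢𝟎 (All.replicate⁺ n g≢𝟎))))
  go (x ∷ y ∷ []) (_ , eq) p
    with refl ← x⊕y≡𝟎⇒x≡y x y (≡.trans (cong (x ⊕_) (sym (⊕-identityʳ y))) eq)
    with refl ← repeated {U} {n} {g} U! p
    = subst (c ≤_) (cong (w W x +_) (sym (ℕ.+-identityʳ (w W x)))) c≤2g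
  go (x ∷ y ∷ z ∷ []) (_ , eq) p = triple x y z eq
  go (x ∷ y ∷ z ∷ t ∷ T) _ _ =
    ℕ.≤-trans four (ℕ.≤-trans (ℕ.*-monoˡ-≤ μ (ℕ.m≤m+n 4 (length T)))
      (weight-≥ (w W) min (x ∷ y ∷ z ∷ t ∷ T)))

-- In a zero-sum triple an even number of first coordinates is 1, so zero or two of its points lie
-- off the hyperplane, and it weighs 6 or 4.
affineWeighting : Weighting 4 1
affineWeighting = record { w = v ; min = min ; triple = triple ; four = ℕ.≤-refl }
  where
  v : V → ℕ
  v (0ℙ ∷ _) = 2
  v (1ℙ ∷ _) = 1
  min : ∀ x → 1 ≤ v x
  min (0ℙ ∷ _) = s≤s z≤n
  min (1ℙ ∷ _) = s≤s z≤n
  triple : ∀ x y z → sum (x ∷ y ∷ z ∷ []) ≡ 𝟎 → 4 ≤ weight v (x ∷ y ∷ z ∷ [])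
  triple (0ℙ ∷ _) (0ℙ ∷ _) (0ℙ ∷ _) _ = ℕ.m≤m+n 4 2
  triple (0ℙ ∷ _) (1ℙ ∷ _) (1ℙ ∷ _) _ = ℕ.≤-refl
  triple (1ℙ ∷ _) (0ℙ ∷ _) (1ℙ ∷ _) _ = ℕ.≤-refl
  triple (1ℙ ∷ _) (1ℙ ∷ _) (0ℙ ∷ _) _ = ℕ.≤-refl
  triple (0ℙ ∷ _) (0ℙ ∷ _) (1ℙ ∷ _) eq = contradiction (cong Vec.head eq) λ ()
  triple (0ℙ ∷ _) (1ℙ ∷ _) (0ℙ ∷ _) eq = contradiction (cong Vec.head eq) λ ()
  triple (1ℙ ∷ _) (0ℙ ∷ _) (0ℙ ∷ _) eq = contradiction (cong Vec.head eq) λ ()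
  triple (1ℙ ∷ _) (1ℙ ∷ _) (1ℙ ∷ _) eq = contradiction (cong Vec.head eq) λ ()

-- Three terms weigh at least 6 anyway; weight 3 on `g` makes a pair of copies of `g` weigh 6 as
-- well.
markedWeighting : V → Weighting 6 2
markedWeighting g = record
  { w      = v
  ; min    = min
  ; triple = λ x y z _ → weight-≥ v min (x ∷ y ∷ z ∷ [])
  ; four   = ℕ.m≤m+n 6 2
  }
  where
  v : V → ℕ
  v x with x ≟ g
  ... | yes _ = 3
  ... | no  _ = 2
  min : ∀ x → 2 ≤ v x
  min x with x ≟ g
  ... | yes _ = ℕ.m≤m+n 2 1
  ... | no  _ = ℕ.≤-refl

-- `s` stands for the sum of the sequence, and `g ∷ U` contains all its terms, however often `g` is
-- repeated. The number of copies does not enter, so one check covers an infinite family.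
Extremal : ∀ {c μ} → Weighting c μ → List V → V → V → Set
Extremal {c} W U g s = Simple U × g ≢ 𝟎 × c ≤ w W g + w W g × s ≢ 𝟎 × s ∉ g ∷ U

extremal? : ∀ {c μ} (W : Weighting c μ) U g s → Dec (Extremal W U g s)
extremal? {c} W U g s =
  simple? U ×-dec ¬? (g ≟ 𝟎) ×-dec (c ℕ.≤? w W g + w W g) ×-dec ¬? (s ≟ 𝟎) ×-dec ¬? (s ∈? (g ∷ U))

extremal-no-split : ∀ {c μ} (W : Weighting c μ) U n g {k s} →
  sum (U ++ replicate n g) ≡ s → Extremal W U g s → weight (w W) U + n * w W g < k * c + 2 * μ →
  ¬ Split k (U ++ replicate n g)
extremal-no-split W U n g refl (U-simple , g≢𝟎 , c≤2g , s≢𝟎 , s∉) small =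
  no-split (heavy W n U-simple g≢𝟎 c≤2g) (Weighting.min W)
    (subst (_< _) (sym weight-S) small) s≢𝟎 λ s∈ → s∉ (locate (∈-++⁻ U s∈))
  where
  weight-S : weight (w W) (U ++ replicate n g) ≡ weight (w W) U + n * w W g
  weight-S = ≡.trans (weight-++ (w W) U (replicate n g))
    (cong (weight (w W) U +_) (weight-replicate (w W) n g))
  locate : ∀ {s} → s ∈ U ⊎ s ∈ replicate n g → s ∈ g ∷ U
  locate (inj₁ s∈U)   = there s∈U
  locate (inj₂ s∈rep) = here (∈-replicate⁻ n s∈rep)

affine : List V
affine = map (1ℙ ∷_) (allVecs 4)

infixl 6 _∖_

_∖_ : List V → List V → List V
S ∖ X = filter (λ x → ¬? (x ∈? X)) S

no-split-by-evaluation : ∀ {c μ} (W : Weighting c μ) U n g {k}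
  {_ : True (extremal? W U g (sum (U ++ replicate n g)))}
  {_ : True (weight (w W) U + n * w W g ℕ.<? k * c + 2 * μ)} → ¬ Split k (U ++ replicate n g)
no-split-by-evaluation W U n g {_} {ex} {small} =
  extremal-no-split W U n g refl (toWitness ex) (toWitness small)

e₀ e₁ e₂ : V
e₀ = bits 5 1
e₁ = bits 5 2
e₂ = bits 5 4

sum-odd : ∀ U g m → sum (U ++ replicate (1 + m * 2) g) ≡ sum U ⊕ g
sum-odd U g m = ≡.trans (sum-++ U (replicate (1 + m * 2) g)) (cong (sum U ⊕_) (odd m))
  where
  odd : ∀ m → sum (replicate (1 + m * 2) g) ≡ g
  odd zero    = ⊕-identityʳ g
  odd (suc m) = ≡.trans (⊕-cancel g _) (odd m)

-- All points have sum zero, so `U` has sum `e₀ ⊕ e₁`, and the odd number of copies of `e₀` turns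
-- this into `e₁`, which is not a term. Two more copies add weight 6, exactly what one more block
-- requires.
no-split₁₀₊ : ∀ m → ¬ Split (10 + m) (nonzeros ∖ (e₀ ∷ e₁ ∷ []) ++ replicate (1 + m * 2) e₀)
no-split₁₀₊ m = extremal-no-split (markedWeighting e₀) U (1 + m * 2) e₀ (sum-odd U e₀ m)
  (toWitness {a? = extremal? (markedWeighting e₀) U e₀ e₁} _) small
  where
  U : List V
  U = nonzeros ∖ (e₀ ∷ e₁ ∷ [])
  -- `U` has 29 points of weight 2, since `e₀` is removed. The two sides are 61 + 6m and 64 + 6m.
  small : 58 + (1 + m * 2) * 3 < (10 + m) * 6 + 4
  small = begin
    62 + m * 2 * 3      ≡⟨ cong (62 +_) (ℕ.*-assoc m 2 3) ⟩
    62 + m * 6          ≤⟨ ℕ.+-monoˡ-≤ (m * 6) (ℕ.m≤m+n 62 2) ⟩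
    60 + (4 + m * 6)    ≡⟨ cong (60 +_) (ℕ.+-comm 4 (m * 6)) ⟩
    60 + (m * 6 + 4)    ∎
    where open ℕ.≤-Reasoning

-- Transfer to C₂^ 5

G : AbelianGroup _ _
G = C₂^ 5

open AbelianGroup G using (_≈_; setoid)
open PermutationSetoid setoid using () renaming (↭-trans to ↭ᴳ-trans; ↭-refl to ↭ᴳ-refl; ↭-reflexive to ↭ᴳ-reflexive; ↭-reflexive-≋ to ↭ᴳ-reflexive-≋)

σ-lookup : ∀ T → σ G (map lookup T) ≈ lookup (sum T)
σ-lookup []      i = sym (Vec.lookup-replicate i 0ℙ)
σ-lookup (x ∷ T) i =
  ≡.trans (cong (lookup x i ℙ.+_) (σ-lookup T i)) (sym (Vec.lookup-zipWith ℙ._+_ i x (sum T)))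

sum-tabulate : ∀ T → sum (map tabulate T) ≡ tabulate (σ G T)
sum-tabulate []      = refl
sum-tabulate (g ∷ T) = cong (tabulate g ⊕_) (sum-tabulate T)

Packing⇒HasDisjointZeroSums : ∀ {k S} → Packing k S → HasDisjointZeroSums G k (map lookup S)
Packing⇒HasDisjointZeroSums none = [] , _ , refl , [] , ↭ᴳ-refl
Packing⇒HasDisjointZeroSums (cut {T = T} {R} (T≢[] , eq) p P) =
  let Ts , R′ , |Ts| , zs , q = Packing⇒HasDisjointZeroSums P in
  map lookup T ∷ Ts , R′ , cong suc |Ts|
  , (nonEmpty T T≢[] , λ i → ≡.trans (σ-lookup T i)
      (≡.trans (cong (λ x → lookup x i) eq) (Vec.lookup-replicate i 0ℙ))) ∷ zs
  , ↭ᴳ-trans (Permutationₛ.map⁺ (≡.setoid V) setoid (λ x≡y i → cong (λ x → lookup x i) x≡y) (↭⇒↭ₛ p))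
      (↭ᴳ-trans (↭ᴳ-reflexive (map-++ lookup T R))
        (↭ᴳ-trans (Permutationₛ.++⁺ˡ setoid (map lookup T) q)
          (↭ᴳ-reflexive (sym (++-assoc (map lookup T) (concat Ts) R′)))))
  where
  nonEmpty : ∀ T → T ≢ [] → map lookup T ≢ []
  nonEmpty []      T≢[] _ = T≢[] refl
  nonEmpty (_ ∷ _) _ ()

-- `lookup` undoes `tabulate` up to pointwise equality, which is the equality of the group; hence
-- the detour through a pointwise reflexive permutation.
Upper⇒ : ∀ {k n} → Upper k n → ∀ S → n ≤ length S → HasDisjointZeroSums G k S
Upper⇒ {k} {n} U S n≤S =
  let Ts , R , |Ts| , zs , p = Packing⇒HasDisjointZeroSums
        (U (map tabulate S) (subst (n ≤_) (sym (length-map tabulate S)) n≤S))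
  in Ts , R , |Ts| , zs , ↭ᴳ-trans (↭ᴳ-reflexive-≋ (there-and-back S)) p
  where
  there-and-back : ∀ S → Pointwise _≈_ S (map lookup (map tabulate S))
  there-and-back []      = []
  there-and-back (g ∷ S) = (λ i → sym (Vec.lookup∘tabulate g i)) ∷ there-and-back S

-- In this direction `tabulate` undoes `lookup` propositionally, and it turns pointwise equality
-- into propositional equality, hence setoid permutations into propositional ones.
HasDisjointZeroSums⇒Split : ∀ {k} S → HasDisjointZeroSums G k (map lookup S) → Split k S
HasDisjointZeroSums⇒Split S (Ts , R , |Ts| , zs , p) =
  map (map tabulate) Ts , map tabulate R , ≡.trans (length-map (map tabulate) Ts) |Ts|
  , All.map⁺ (All.map zeroSum zs)
  , subst₂ _↭_ (≡.trans (sym (map-∘ S)) (≡.trans (map-cong Vec.tabulate∘lookup S) (map-id S)))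
      (≡.trans (map-++ tabulate (concat Ts) R) (cong (_++ map tabulate R) (sym (concat-map Ts))))
      (↭ₛ⇒↭ (Permutationₛ.map⁺ setoid (≡.setoid V) Vec.tabulate-cong p))
  where
  zeroSum : ∀ {T} → NonEmptyZeroSum G T → ZeroSum (map tabulate T)
  zeroSum {[]}    (T≢[] , _) = contradiction refl T≢[]
  zeroSum {g ∷ T} (_ , eq)   = (λ ()) , ≡.trans (sum-tabulate (g ∷ T)) (Vec.tabulate-cong eq)

-- The values of D_k, and the constants D_0 and k_D

-- `S` is one term shorter than the claimed value. If some `m ≤ n` had the defining property, it
-- would apply to `S` and split it.
isD : ∀ {k n} S → length S ≡ n → ¬ Split k S → Upper k (suc n) → IsD G k (suc n)
isD {k} {n} S |S| ¬split U = Upper⇒ U , λ m all → ℕ.≰⇒> λ m≤n →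
  ¬split (HasDisjointZeroSums⇒Split S (all (map lookup S)
    (subst (m ≤_) (sym (≡.trans (length-map lookup S) |S|)) m≤n)))

isD₁ : IsD G 1 6
-- For k ≤ 4 the sequence is `U` itself, off the hyperplane and of weight equal to its length; `0`
-- is the number of copies of `e₁`, a point of weight 2 different from the sum.
isD₁ = isD _ refl (no-split-by-evaluation affineWeighting U 0 e₁) upper₁
  where
  U : List V
  -- `e₀` and its sums with the other four basis vectors; all coordinates of the total are 1.
  U = points (1 ∷ 3 ∷ 5 ∷ 9 ∷ 17 ∷ [])

isD₂ : IsD G 2 10
isD₂ = isD _ refl (no-split-by-evaluation affineWeighting U 0 e₁) upper₂
  where
  U : List V
  U = points (1 ∷ 3 ∷ 5 ∷ 7 ∷ 9 ∷ 11 ∷ 17 ∷ 21 ∷ 25 ∷ [])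

isD₃ : IsD G 3 13
isD₃ = isD _ refl (no-split-by-evaluation affineWeighting U 0 e₁) upper₃
  where
  U : List V
  -- `affine` has sum zero, so `U` has the sum of the four removed points, a nonzero vector on the
  -- hyperplane, whereas `U` lies off it.
  U = affine ∖ points (1 ∷ 3 ∷ 5 ∷ 9 ∷ [])

isD₄ : IsD G 4 16
-- The sum is the removed point `e₀`.
isD₄ = isD _ refl (no-split-by-evaluation affineWeighting (affine ∖ (e₀ ∷ [])) 0 e₁) upper₄

isD₅ : IsD G 5 19
-- For k = 5, 6, 7 the copies of `e₂` are odd in number, so the sum is `e₁ ⊕ e₂`, which is not a
-- term. Two more copies add weight 4, as much as one more block requires.
isD₅ = isD _ refl (no-split-by-evaluation affineWeighting (e₁ ∷ affine) 1 e₂) upper₅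

isD₆ : IsD G 6 21
isD₆ = isD _ refl (no-split-by-evaluation affineWeighting (e₁ ∷ affine) 3 e₂) upper₆

isD₇ : IsD G 7 23
isD₇ = isD _ refl (no-split-by-evaluation affineWeighting (e₁ ∷ affine) 5 e₂) upper₇

-- All points have sum 0, so U has the sum of the removed points; for k = 8 the first
-- five of these have sum 0, for k = 9 the first three.
isD₈ : IsD G 8 26
isD₈ = isD _ refl (no-split-by-evaluation (markedWeighting e₀) U 0 e₀) upper₈
  where
  U : List V
  U = nonzeros ∖ points (1 ∷ 2 ∷ 4 ∷ 8 ∷ 15 ∷ 16 ∷ [])

isD₉ : IsD G 9 28
isD₉ = isD _ refl (no-split-by-evaluation (markedWeighting e₀) U 0 e₀) upper₉
  where
  U : List V
  U = nonzeros ∖ points (1 ∷ 2 ∷ 3 ∷ 4 ∷ [])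

isD₁₀₊ : EventuallyLinearFrom G 2 11 10
isD₁₀₊ k 10≤k with ℕ.m≤n⇒∃[o]m+o≡n 10≤k
... | m , refl = isD (nonzeros ∖ (e₀ ∷ e₁ ∷ []) ++ replicate (1 + m * 2) e₀)
  (cong (30 +_) (length-replicate (m * 2))) (no-split₁₀₊ m) (upper₁₀₊ m)

exponent : IsExponent G 2
exponent = (s≤s z≤n , twice) , least
  where
  twice : ∀ g i → g i ℙ.+ (g i ℙ.+ 0ℙ) ≡ 0ℙ
  twice g i = ≡.trans (cong (g i ℙ.+_) (ℙ.+-identityʳ (g i))) (ℙ.p+p≡0ℙ (g i))
  least : ∀ m → 1 ≤ m × _ → 2 ≤ m
  least 1 (_ , kills) = contradiction (kills (λ _ → 1ℙ) zero) λ ()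
  least (suc (suc m)) _ = s≤s (s≤s z≤n)

isD₀ : IsD₀ G 11
isD₀ = 2 , exponent , 10 , isD₁₀₊

isk-D : Isk-D G 10
-- Linearity from some `k ≤ 9` on would make 11 + 18 = 29 the least value at 9, although 28 has the
-- defining property.
isk-D = 2 , 11 , exponent , isD₀ , (s≤s z≤n , isD₁₀₊) , λ k (_ , linear) → ℕ.≰⇒> λ k≤9 →
  ℕ.1+n≰n (proj₂ (linear 9 k≤9) 28 (proj₁ isD₉))

theorem7p10 : IsD₀ (C₂^ 5) 11 × Isk-D (C₂^ 5) 10 ×
    IsD (C₂^ 5) 1 6 × IsD (C₂^ 5) 2 10 × IsD (C₂^ 5) 3 13 ×
    IsD (C₂^ 5) 4 16 × IsD (C₂^ 5) 5 19 × IsD (C₂^ 5) 6 21 ×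
    IsD (C₂^ 5) 7 23 × IsD (C₂^ 5) 8 26 × IsD (C₂^ 5) 9 28
theorem7p10 =
  isD₀ , isk-D , isD₁ , isD₂ , isD₃ , isD₄ , isD₅ , isD₆ , isD₇ , isD₈ , isD₉
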